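{- Let $H$ be a finitary endofunctor of a locally finitely presentable category $\mathcal A$, and let $\mathbb R$ be the rational monad of $H$. Then the category $\mathrm{Elgot}\,H$ of Elgot algebras and solution-preserving morphisms is isomorphic to the Eilenberg--Moore category $\mathcal A^{\mathbb R}$ of $\mathbb R$-algebras.
   Context: $H$ is finitary if it preserves filtered colimits; $X$ is finitely presentable if $\mathcal A(X,-)$ preserves filtered colimits. Coproduct injections are $\mathrm{inl},\mathrm{inr}$. For an $H$-algebra $\alpha:HA\to A$, a finitary flat equation morphism in $A$ is $e:X\to HX+A$ with $X$ finitely presentable; a solution is $e^\dagger:X\to A$ with $e^\dagger=[\alpha,\mathrm{id}_A]\cdot(He^\dagger+\mathrm{id}_A)\cdot e$. An iterative algebra is an $H$-algebra where every finitary flat equation morphism has a unique solution. Free iterative algebras $RY$ exist on every object $Y$ in this setting; the rational monad $\mathbb R=(R,\eta,\mu)$ is the monad arising from the free iterative algebra adjunction. For $e:X\to HX+Y$ and $h:Y\to Z$, $h\bullet e:=(\mathrm{id}_{HX}+h)\cdot e$; for $e:X\to HX+Y$, $f:Y\to HY+A$, $f\oplus e:=(\mathrm{can}+\mathrm{id}_A)\cdot(\mathrm{id}_{HX}+f)\cdot[e,\mathrm{inr}]:X+Y\to H(X+Y)+A$ with $\mathrm{can}=[H\mathrm{inl},H\mathrm{inr}]$. An Elgot algebra is an $H$-algebra with an assignment $e\mapsto e^\dagger$ of a solution to every finitary flat equation morphism that is functorial ($e^\dagger=f^\dagger\cdot h$ whenever $e:X\to HX+A$, $f:Y\to HY+A$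 finitary and $(Hh+\mathrm{id}_A)\cdot e=f\cdot h$) and compositional ($(f^\dagger\bullet e)^\dagger=(f\oplus e)^\dagger\cdot\mathrm{inl}$ for finitary $e:X\to HX+Y$, $f:Y\to HY+A$). A morphism $h:A\to B$ of Elgot algebras $(A,\alpha,(-)^\dagger)$, $(B,\beta,(-)^\ddagger)$ is solution-preserving if $h\cdot e^\dagger=(h\bullet e)^\ddagger$ for all finitary flat equation morphisms $e$ in $A$. -}

module Defs where

open import Level using (Level; _⊔_) renaming (suc to lsuc)
open import Data.Product using (Σ; _×_; _,_; proj₁; proj₂)
open import Relation.Binary using (IsEquivalence; Setoid)
open import Relation.Binary.PropositionalEquality using (_≡_)

record Category (o ℓ e : Level) : Set (lsuc (o ⊔ ℓ ⊔ e)) where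
  infix  4 _≈_ _⇒_
  infixr 9 _∘_
  field
    Obj       : Set o
    _⇒_       : Obj → Obj → Set ℓ
    _≈_       : ∀ {A B} → A ⇒ B → A ⇒ B → Set e
    id        : ∀ {A} → A ⇒ A
    _∘_       : ∀ {A B C} → B ⇒ C → A ⇒ B → A ⇒ C
    equiv     : ∀ {A B} → IsEquivalence (_≈_ {A} {B})
    assoc     : ∀ {A B C D} {f : A ⇒ B} {g : B ⇒ C} {h : C ⇒ D} →
                (h ∘ g) ∘ f ≈ h ∘ (g ∘ f)
    identityˡ : ∀ {A B} {f : A ⇒ B} → id ∘ f ≈ f
    identityʳ : ∀ {A B} {f : A ⇒ B} → f ∘ id ≈ f
    ∘-resp-≈  : ∀ {A B C} {f h : B ⇒ C} {g i : A ⇒ B} →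
                f ≈ h → g ≈ i → f ∘ g ≈ h ∘ i

record Functor {o ℓ e o′ ℓ′ e′} (C : Category o ℓ e) (D : Category o′ ℓ′ e′)
       : Set (o ⊔ ℓ ⊔ e ⊔ o′ ⊔ ℓ′ ⊔ e′) where
  private
    module C = Category C
    module D = Category D
  field
    F₀           : C.Obj → D.Obj
    F₁           : ∀ {A B} → A C.⇒ B → F₀ A D.⇒ F₀ B
    identity     : ∀ {A} → F₁ (C.id {A}) D.≈ D.id
    homomorphism : ∀ {X Y Z} {f : X C.⇒ Y} {g : Y C.⇒ Z} →
                   F₁ (g C.∘ f) D.≈ F₁ g D.∘ F₁ f
    F-resp-≈     : ∀ {A B} {f g : A C.⇒ B} → f C.≈ g → F₁ f D.≈ F₁ g

record Filtered {o ℓ e} (J : Category o ℓ e) : Set (o ⊔ ℓ ⊔ e) where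
  open Category J
  field
    inhabited : Obj
    upper     : ∀ i j → Σ Obj λ k → (i ⇒ k) × (j ⇒ k)
    equalise  : ∀ {i j} (f g : i ⇒ j) → Σ Obj λ k → Σ (j ⇒ k) λ h → h ∘ f ≈ h ∘ g

-- Colimits, finitary functors, finitely presentable objects, lfp categories.
-- Small diagrams are indexed by categories J : Category ℓ ℓ ℓ, where ℓ is
-- the hom-level of the (locally small) category 𝒜 : Category o ℓ ℓ.

module _ {o ℓ} (𝒜 : Category o ℓ ℓ) where
  open Category 𝒜

  SmallCat : Set (lsuc ℓ)
  SmallCat = Category ℓ ℓ ℓ

  record IsColimit (J : SmallCat)
                   (D₀ : Category.Obj J → Obj)
                   (D₁ : ∀ {i j} → Category._⇒_ J i j → D₀ i ⇒ D₀ j)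
                   (C : Obj) (ι : ∀ j → D₀ j ⇒ C) : Set (o ⊔ ℓ) where
    field
      commute   : ∀ {i j} (f : Category._⇒_ J i j) → ι j ∘ D₁ f ≈ ι i
      universal : ∀ (C′ : Obj) (κ : ∀ j → D₀ j ⇒ C′) →
                  (∀ {i j} (f : Category._⇒_ J i j) → κ j ∘ D₁ f ≈ κ i) →
                  Σ (C ⇒ C′) λ u →
                    (∀ j → u ∘ ι j ≈ κ j) ×
                    (∀ (u′ : C ⇒ C′) → (∀ j → u′ ∘ ι j ≈ κ j) → u′ ≈ u)

  HasColimit : (J : SmallCat) → Functor J 𝒜 → Set (o ⊔ ℓ)
  HasColimit J D = Σ Obj λ C → Σ (∀ j → F₀ j ⇒ C) λ ι → IsColimit J F₀ F₁ C ι
    where open Functor D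

  Cocomplete : Set (o ⊔ lsuc ℓ)
  Cocomplete = (J : SmallCat) (D : Functor J 𝒜) → HasColimit J D

  Finitary : Functor 𝒜 𝒜 → Set (o ⊔ lsuc ℓ)
  Finitary H = (J : SmallCat) → Filtered J → (D : Functor J 𝒜) →
               (C : Obj) (ι : ∀ j → Functor.F₀ D j ⇒ C) →
               IsColimit J (Functor.F₀ D) (Functor.F₁ D) C ι →
               IsColimit J (λ j → Functor.F₀ H (Functor.F₀ D j))
                           (λ f → Functor.F₁ H (Functor.F₁ D f))
                           (Functor.F₀ H C) (λ j → Functor.F₁ H (ι j))

  -- The hom-functor 𝒜(X,-) : 𝒜 → Setoid ℓ ℓ sends the colimit cocone
  -- (C , ι) of D to a colimit cocone in Setoid ℓ ℓ
  -- (universal property in Setoid, written out).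
  HomPreservesColimit : (X : Obj) (J : SmallCat) (D : Functor J 𝒜)
                        (C : Obj) (ι : ∀ j → Functor.F₀ D j ⇒ C) → Set (lsuc ℓ)
  HomPreservesColimit X J D C ι =
    (S : Setoid ℓ ℓ) →
    let open Setoid S renaming (Carrier to |S|; _≈_ to _≈S_) in
    (κ : ∀ j → X ⇒ F₀ j → |S|) →
    (∀ j {g g′ : X ⇒ F₀ j} → g ≈ g′ → κ j g ≈S κ j g′) →
    (∀ {i j} (f : Category._⇒_ J i j) (g : X ⇒ F₀ i) → κ j (F₁ f ∘ g) ≈S κ i g) →
    Σ (X ⇒ C → |S|) λ u →
      (∀ {h h′ : X ⇒ C} → h ≈ h′ → u h ≈S u h′) ×
      (∀ j (g : X ⇒ F₀ j) → u (ι j ∘ g) ≈S κ j g) ×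
      (∀ (u′ : X ⇒ C → |S|) →
         (∀ {h h′ : X ⇒ C} → h ≈ h′ → u′ h ≈S u′ h′) →
         (∀ j (g : X ⇒ F₀ j) → u′ (ι j ∘ g) ≈S κ j g) →
         ∀ (h : X ⇒ C) → u′ h ≈S u h)
    where open Functor D

  IsFP : Obj → Set (o ⊔ lsuc ℓ)
  IsFP X = (J : SmallCat) → Filtered J → (D : Functor J 𝒜) →
           (C : Obj) (ι : ∀ j → Functor.F₀ D j ⇒ C) →
           IsColimit J (Functor.F₀ D) (Functor.F₁ D) C ι →
           HomPreservesColimit X J D C ι

  record LFP : Set (o ⊔ lsuc ℓ) where
    field
      cocomplete : Cocomplete
      Gen        : Set ℓ
      gen        : Gen → Obj
      gen-fp     : ∀ i → IsFP (gen i)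
      dense      : ∀ (A : Obj) →
                   Σ SmallCat λ J → Filtered J × Σ (Functor J 𝒜) λ D →
                     (∀ j → Σ Gen λ i → Functor.F₀ D j ≡ gen i) ×
                     Σ (∀ j → Functor.F₀ D j ⇒ A) λ ι →
                       IsColimit J (Functor.F₀ D) (Functor.F₁ D) A ι

  -- A choice of binary coproducts (they exist in any cocomplete category).
  record BinaryCoproducts : Set (o ⊔ ℓ) where
    infixr 6 _+_
    field
      _+_     : Obj → Obj → Obj
      inl     : ∀ {A B} → A ⇒ A + B
      inr     : ∀ {A B} → B ⇒ A + B
      [_,_]   : ∀ {A B C} → A ⇒ C → B ⇒ C → A + B ⇒ C
      inject₁ : ∀ {A B C} {f : A ⇒ C} {g : B ⇒ C} → [ f , g ] ∘ inl ≈ f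
      inject₂ : ∀ {A B C} {f : A ⇒ C} {g : B ⇒ C} → [ f , g ] ∘ inr ≈ g
      unique  : ∀ {A B C} {f : A ⇒ C} {g : B ⇒ C} {h : A + B ⇒ C} →
                h ∘ inl ≈ f → h ∘ inr ≈ g → h ≈ [ f , g ]

    infixr 6 _+₁_
    _+₁_ : ∀ {A B C D} → A ⇒ C → B ⇒ D → A + B ⇒ C + D
    f +₁ g = [ inl ∘ f , inr ∘ g ]

module Algebras {o ℓ} {𝒜 : Category o ℓ ℓ} (cp : BinaryCoproducts 𝒜)
                (H : Functor 𝒜 𝒜) where
  open Category 𝒜
  open BinaryCoproducts cp
  open Functor H

  IsAlgHom : ∀ {A B} → F₀ A ⇒ A → F₀ B ⇒ B → A ⇒ B → Set ℓ
  IsAlgHom α β h = h ∘ α ≈ β ∘ F₁ h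

  IsSolution : ∀ {X A} → F₀ A ⇒ A → X ⇒ F₀ X + A → X ⇒ A → Set ℓ
  IsSolution α e s = s ≈ [ α , id ] ∘ ((F₁ s +₁ id) ∘ e)

  _•_ : ∀ {X Y Z} → Y ⇒ Z → X ⇒ F₀ X + Y → X ⇒ F₀ X + Z
  h • e = (id +₁ h) ∘ e

  can : ∀ {X Y} → F₀ X + F₀ Y ⇒ F₀ (X + Y)
  can = [ F₁ inl , F₁ inr ]

  -- the canonical associativity isomorphism B + (C + D) ≅ (B + C) + D
  -- (left implicit in the paper's formula for f ⊕ e)
  assocˡ : ∀ {B C D} → B + (C + D) ⇒ (B + C) + D
  assocˡ = [ inl ∘ inl , [ inl ∘ inr , inr ] ]

  _⊕_ : ∀ {X Y A} → Y ⇒ F₀ Y + A → X ⇒ F₀ X + Y → X + Y ⇒ F₀ (X + Y) + A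
  f ⊕ e = (can +₁ id) ∘ (assocˡ ∘ ((id +₁ f) ∘ [ e , inr ]))

  IsIterative : (A : Obj) → F₀ A ⇒ A → Set (o ⊔ lsuc ℓ)
  IsIterative A α = ∀ (X : Obj) → IsFP 𝒜 X → (e : X ⇒ F₀ X + A) →
                    Σ (X ⇒ A) λ s → IsSolution α e s ×
                      (∀ (s′ : X ⇒ A) → IsSolution α e s′ → s′ ≈ s)

  -- Elgot algebra structure on a carrier A.  The solution operation
  -- takes the finite-presentability witness as an argument; by
  -- functoriality (with h = id) it does not depend on that witness.
  record ElgotStr (A : Obj) : Set (o ⊔ lsuc ℓ) where
    field
      α        : F₀ A ⇒ A
      sol      : ∀ {X} → IsFP 𝒜 X → X ⇒ F₀ X + A → X ⇒ A
      solution : ∀ {X} (p : IsFP 𝒜 X) (e : X ⇒ F₀ X + A) → IsSolution α e (sol p e)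
      functorial : ∀ {X Y} (p : IsFP 𝒜 X) (q : IsFP 𝒜 Y)
                     (e : X ⇒ F₀ X + A) (f : Y ⇒ F₀ Y + A) (h : X ⇒ Y) →
                     (F₁ h +₁ id) ∘ e ≈ f ∘ h → sol p e ≈ sol q f ∘ h
      compositional : ∀ {X Y} (p : IsFP 𝒜 X) (q : IsFP 𝒜 Y) (r : IsFP 𝒜 (X + Y))
                        (e : X ⇒ F₀ X + Y) (f : Y ⇒ F₀ Y + A) →
                        sol p (sol q f • e) ≈ sol r (f ⊕ e) ∘ inl

  _≃Elgot_ : ∀ {A} → ElgotStr A → ElgotStr A → Set (o ⊔ lsuc ℓ)
  s ≃Elgot t = (ElgotStr.α s ≈ ElgotStr.α t) ×
               (∀ {X} (p : IsFP 𝒜 X) e → ElgotStr.sol s p e ≈ ElgotStr.sol t p e)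

  SolPreserving : ∀ {A B} → ElgotStr A → ElgotStr B → A ⇒ B → Set (o ⊔ lsuc ℓ)
  SolPreserving s t h = ∀ {X} (p : IsFP 𝒜 X) (e : X ⇒ F₀ X + _) →
                        h ∘ ElgotStr.sol s p e ≈ ElgotStr.sol t p (h • e)

  record FreeIterative (Y : Obj) : Set (o ⊔ lsuc ℓ) where
    field
      RY       : Obj
      ρ        : F₀ RY ⇒ RY
      iterative : IsIterative RY ρ
      η        : Y ⇒ RY
      extend   : ∀ (B : Obj) (β : F₀ B ⇒ B) → IsIterative B β → Y ⇒ B → RY ⇒ B
      extend-hom : ∀ B β (it : IsIterative B β) (f : Y ⇒ B) →
                   IsAlgHom ρ β (extend B β it f)
      extend-η : ∀ B β (it : IsIterative B β) (f : Y ⇒ B) →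
                 extend B β it f ∘ η ≈ f
      extend-unique : ∀ B β (it : IsIterative B β) (f : Y ⇒ B) (h : RY ⇒ B) →
                      IsAlgHom ρ β h → h ∘ η ≈ f → h ≈ extend B β it f

  module Rational (FI : (Y : Obj) → FreeIterative Y) where
    R₀ : Obj → Obj
    R₀ Y = FreeIterative.RY (FI Y)

    ηR : ∀ {Y} → Y ⇒ R₀ Y
    ηR {Y} = FreeIterative.η (FI Y)

    R₁ : ∀ {Y Z} → Y ⇒ Z → R₀ Y ⇒ R₀ Z
    R₁ {Y} {Z} f = FreeIterative.extend (FI Y) (R₀ Z) (FreeIterative.ρ (FI Z))
                     (FreeIterative.iterative (FI Z)) (ηR ∘ f)

    μR : ∀ {Y} → R₀ (R₀ Y) ⇒ R₀ Y
    μR {Y} = FreeIterative.extend (FI (R₀ Y)) (R₀ Y) (FreeIterative.ρ (FI Y))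
               (FreeIterative.iterative (FI Y)) id

    record EMStr (A : Obj) : Set ℓ where
      field
        a      : R₀ A ⇒ A
        unit-law : a ∘ ηR ≈ id
        mult-law : a ∘ μR ≈ a ∘ R₁ a

    _≃EM_ : ∀ {A} → EMStr A → EMStr A → Set ℓ
    s ≃EM t = EMStr.a s ≈ EMStr.a t

    IsEMHom : ∀ {A B} → EMStr A → EMStr B → A ⇒ B → Set ℓ
    IsEMHom s t h = h ∘ EMStr.a s ≈ EMStr.a t ∘ R₁ h

    -- Isomorphism of categories  Elgot H ≅ 𝒜^𝕣  (commuting with the forgetful
    -- functors to 𝒜): object maps in both directions on the same carrier,
    -- mutually inverse, and morphism maps (identity on underlying morphisms).
    record ElgotIsoEM : Set (o ⊔ lsuc ℓ) where
      field
        Φ    : ∀ {A} → ElgotStr A → EMStr A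
        Ψ    : ∀ {A} → EMStr A → ElgotStr A
        ΨΦ   : ∀ {A} (s : ElgotStr A) → Ψ (Φ s) ≃Elgot s
        ΦΨ   : ∀ {A} (t : EMStr A) → Φ (Ψ t) ≃EM t
        Φ-hom : ∀ {A B} (s : ElgotStr A) (s′ : ElgotStr B) (h : A ⇒ B) →
                SolPreserving s s′ h → IsEMHom (Φ s) (Φ s′) h
        Ψ-hom : ∀ {A B} (t : EMStr A) (t′ : EMStr B) (h : A ⇒ B) →
                IsEMHom t t′ h → SolPreserving (Ψ t) (Ψ t′) h

{-# OPTIONS --safe #-}
module Submission where

-- The flat equations e : X → HX + A with X finitely presentable form a filtered category, and
-- their colimit C is a fixpoint of H(-) + A because H is finitary.  The algebra C is iterative:
-- a solution of an equation with parameters in C exists by ⊕, and it is unique because two maps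
-- X → HY + A merged in HC + A are merged at a later stage.  Hence C ≅ RA, so the
-- approximants (η • e)† : X → RA are a colimit cocone, and an Elgot structure on A, being a
-- compatible family of solutions, amounts to a map a : RA → A with a · (η • e)† = e†.
-- An equation with parameters in RA factors through an approximant, so compositionality of the
-- Elgot structure is the multiplication law of a.

open import Level using (Level; _⊔_)
open import Data.Product using (Σ; _×_; _,_; proj₁; proj₂)
open import Relation.Binary using (IsEquivalence; Setoid)
open import Relation.Binary.PropositionalEquality as ≡ using (_≡_)
import Relation.Binary.Reasoning.Setoid as SetoidReasoning
open import Defs

-- The freeness of RA only yields maps into iterative algebras, while `a` must end in an Elgot
-- algebra, whose solutions need not be unique. So `a` cannot come from `extend`; it needs a
-- description of RA with a universal property for every functorial family of solutions. This is the
-- purpose of the colimit C. Iterativity of C serves the comparison: it is what lets `extend`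
-- produce a map from RA to C. Size is the second obstacle. Finitely presentable objects need not
-- form a small set, but colimits are available over small categories only. The colimit is therefore
-- taken over equations whose variables are a generator, and its cocone is extended to all finitary
-- equations afterwards.

module Morphisms {o ℓ e} (𝒜 : Category o ℓ e) where
  open Category 𝒜

  hom-setoid : Obj → Obj → Setoid ℓ e
  hom-setoid A B = record { Carrier = A ⇒ B ; _≈_ = _≈_ ; isEquivalence = equiv }

  module _ {A B : Obj} where
    open IsEquivalence (equiv {A} {B}) public using (refl; sym; trans)
    open SetoidReasoning (hom-setoid A B) public

  infixr 9 _⟩∘⟨_ refl⟩∘⟨_
  infixl 10 _⟩∘⟨refl

  _⟩∘⟨_ : ∀ {A B C} {f h : B ⇒ C} {g i : A ⇒ B} → f ≈ h → g ≈ i → f ∘ g ≈ h ∘ i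
  _⟩∘⟨_ = ∘-resp-≈

  refl⟩∘⟨_ : ∀ {A B C} {f : B ⇒ C} {g i : A ⇒ B} → g ≈ i → f ∘ g ≈ f ∘ i
  refl⟩∘⟨ p = refl ⟩∘⟨ p

  _⟩∘⟨refl : ∀ {A B C} {f h : B ⇒ C} {g : A ⇒ B} → f ≈ h → f ∘ g ≈ h ∘ g
  p ⟩∘⟨refl = p ⟩∘⟨ refl

  pullˡ : ∀ {A B C D} {f : A ⇒ B} {g : B ⇒ C} {h : C ⇒ D} {k : B ⇒ D} →
          h ∘ g ≈ k → h ∘ (g ∘ f) ≈ k ∘ f
  pullˡ p = trans (sym assoc) (p ⟩∘⟨refl)

  pushˡ : ∀ {A B C D} {f : A ⇒ B} {g : B ⇒ C} {h : C ⇒ D} {k : B ⇒ D} →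
          k ≈ h ∘ g → k ∘ f ≈ h ∘ (g ∘ f)
  pushˡ p = sym (pullˡ (sym p))

  pullʳ : ∀ {A B C D} {f : A ⇒ B} {g : B ⇒ C} {h : C ⇒ D} {k : A ⇒ C} →
          g ∘ f ≈ k → (h ∘ g) ∘ f ≈ h ∘ k
  pullʳ p = trans assoc (refl⟩∘⟨ p)

  pushʳ : ∀ {A B C D} {f : A ⇒ B} {g : B ⇒ C} {h : C ⇒ D} {k : A ⇒ C} →
          k ≈ g ∘ f → h ∘ k ≈ (h ∘ g) ∘ f
  pushʳ p = sym (pullʳ (sym p))

  extendʳ : ∀ {A B B′ C D} {f : A ⇒ B} {g : B ⇒ C} {h : C ⇒ D}
              {g′ : B ⇒ B′} {h′ : B′ ⇒ D} →
            h ∘ g ≈ h′ ∘ g′ → h ∘ (g ∘ f) ≈ h′ ∘ (g′ ∘ f)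
  extendʳ p = trans (pullˡ p) assoc

  elimˡ : ∀ {A B} {f : A ⇒ B} {u : B ⇒ B} → u ≈ id → u ∘ f ≈ f
  elimˡ p = trans (p ⟩∘⟨refl) identityˡ

  elimʳ : ∀ {A B} {f : A ⇒ B} {u : A ⇒ A} → u ≈ id → f ∘ u ≈ f
  elimʳ p = trans (refl⟩∘⟨ p) identityʳ

  cancelˡ : ∀ {A B C} {f : A ⇒ B} {g : B ⇒ C} {h : C ⇒ B} → h ∘ g ≈ id → h ∘ (g ∘ f) ≈ f
  cancelˡ p = trans (pullˡ p) identityˡ

  cancelʳ : ∀ {A B C} {f : B ⇒ C} {g : A ⇒ B} {h : B ⇒ A} → g ∘ h ≈ id → (f ∘ g) ∘ h ≈ f
  cancelʳ p = trans (pullʳ p) identityʳ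

-- Binary coproducts

module Coproducts {o ℓ} {𝒜 : Category o ℓ ℓ} (cp : BinaryCoproducts 𝒜) where
  open Category 𝒜
  open Morphisms 𝒜
  open BinaryCoproducts cp

  +-ext : ∀ {A B C} {f g : A + B ⇒ C} → f ∘ inl ≈ g ∘ inl → f ∘ inr ≈ g ∘ inr → f ≈ g
  +-ext p q = trans (unique p q) (sym (unique refl refl))

  []-cong : ∀ {A B C} {f f′ : A ⇒ C} {g g′ : B ⇒ C} → f ≈ f′ → g ≈ g′ → [ f , g ] ≈ [ f′ , g′ ]
  []-cong p q = unique (trans inject₁ p) (trans inject₂ q)

  ∘[] : ∀ {A B C D} {f : A ⇒ C} {g : B ⇒ C} {h : C ⇒ D} → h ∘ [ f , g ] ≈ [ h ∘ f , h ∘ g ]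
  ∘[] = unique (pullʳ inject₁) (pullʳ inject₂)

  []∘+₁ : ∀ {A B A′ B′ C} {f : A′ ⇒ C} {g : B′ ⇒ C} {h : A ⇒ A′} {k : B ⇒ B′} →
          [ f , g ] ∘ (h +₁ k) ≈ [ f ∘ h , g ∘ k ]
  []∘+₁ = unique (trans (pullʳ inject₁) (pullˡ inject₁)) (trans (pullʳ inject₂) (pullˡ inject₂))

  +₁∘inl : ∀ {A B C D} {f : A ⇒ C} {g : B ⇒ D} → (f +₁ g) ∘ inl ≈ inl ∘ f
  +₁∘inl = inject₁

  +₁∘inr : ∀ {A B C D} {f : A ⇒ C} {g : B ⇒ D} → (f +₁ g) ∘ inr ≈ inr ∘ g
  +₁∘inr = inject₂

  +₁-cong : ∀ {A B C D} {f f′ : A ⇒ C} {g g′ : B ⇒ D} → f ≈ f′ → g ≈ g′ → f +₁ g ≈ f′ +₁ g′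
  +₁-cong p q = []-cong (refl⟩∘⟨ p) (refl⟩∘⟨ q)

  +₁∘+₁ : ∀ {A B A′ B′ A″ B″} {f : A′ ⇒ A″} {g : B′ ⇒ B″} {h : A ⇒ A′} {k : B ⇒ B′} →
          (f +₁ g) ∘ (h +₁ k) ≈ (f ∘ h) +₁ (g ∘ k)
  +₁∘+₁ = trans []∘+₁ ([]-cong assoc assoc)

  []-η : ∀ {A B} → [ inl , inr ] ≈ id {A + B}
  []-η = sym (unique identityˡ identityˡ)

  +₁-identity : ∀ {A B} → id {A} +₁ id {B} ≈ id
  +₁-identity = trans ([]-cong identityʳ identityʳ) []-η

-- Finite presentability as essentially unique factorisation; coequalizers

module FilteredColimits {o ℓ} (𝒜 : Category o ℓ ℓ) where
  open Category 𝒜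
  open Morphisms 𝒜

  colimit-ext : ∀ {J : SmallCat 𝒜} {D₀ : Category.Obj J → Obj}
                  {D₁ : ∀ {i j} → Category._⇒_ J i j → D₀ i ⇒ D₀ j} {C ι} →
                IsColimit 𝒜 J D₀ D₁ C ι → ∀ {B} {f g : C ⇒ B} →
                (∀ j → f ∘ ι j ≈ g ∘ ι j) → f ≈ g
  colimit-ext {J = J} isC {B} {f} {g} p =
    let open IsColimit isC
        (_ , _ , uniq) = universal B (λ j → g ∘ _) (λ h → pullʳ (commute h))
    in trans (uniq f p) (sym (uniq g (λ _ → refl)))

  -- The elementwise form of preservation of a filtered colimit by the hom-functor of X. Merging two
  -- maps at one common stage is enough, since filteredness brings any two stages together first.
  record HomFactors (X : Obj) {J : SmallCat 𝒜} (D : Functor J 𝒜) {C : Obj}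
                    (ι : ∀ j → Functor.F₀ D j ⇒ C) : Set (o ⊔ ℓ) where
    open Functor D
    field
      factor : (h : X ⇒ C) → Σ (Category.Obj J) λ j → Σ (X ⇒ F₀ j) λ g → ι j ∘ g ≈ h
      merge  : ∀ {j} (g g′ : X ⇒ F₀ j) → ι j ∘ g ≈ ι j ∘ g′ →
               Σ (Category.Obj J) λ k → Σ (Category._⇒_ J j k) λ f → F₁ f ∘ g ≈ F₁ f ∘ g′

  module _ {X : Obj} {J : SmallCat 𝒜} (filt : Filtered J) (D : Functor J 𝒜) where
    private
      module J = Category J
      open Functor D
      open Filtered filt

      F-commute : ∀ {i j j′ k} {f : i J.⇒ j} {h : j J.⇒ k} {f′ : i J.⇒ j′} {h′ : j′ J.⇒ k} →
                  h J.∘ f J.≈ h′ J.∘ f′ → F₁ h ∘ F₁ f ≈ F₁ h′ ∘ F₁ f′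
      F-commute p = trans (sym homomorphism) (trans (F-resp-≈ p) homomorphism)

    -- The equivalence relation presenting the filtered colimit of the hom-sets 𝒜(X, D j). Used as
    -- the test setoid of `HomPreservesColimit`, it turns a universal property into actual
    -- factorisations.
    record SameGerm (x y : Σ J.Obj λ j → X ⇒ F₀ j) : Set ℓ where
      constructor same-germ
      field
        {apex} : J.Obj
        left   : proj₁ x J.⇒ apex
        right  : proj₁ y J.⇒ apex
        agree  : F₁ left ∘ proj₂ x ≈ F₁ right ∘ proj₂ y

    germs : Setoid ℓ ℓ
    germs = record
      { Carrier = Σ J.Obj λ j → X ⇒ F₀ j
      ; _≈_ = SameGerm
      ; isEquivalence = record
        { refl  = same-germ J.id J.id refl
        ; sym   = λ (same-germ f f′ p) → same-germ f′ f (sym p)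
        ; trans = transitive
        }
      }
      where
      transitive : ∀ {x y z} → SameGerm x y → SameGerm y z → SameGerm x z
      transitive {_ , g} {_ , g′} {_ , g″} (same-germ {k} f f′ p) (same-germ {k′} h h′ q) =
        let (l , a , b) = upper k k′
            -- The two witnesses give two unrelated paths from the middle stage to `l`; beyond `m`
            -- they coincide.
            (m , c , r) = equalise (a J.∘ f′) (b J.∘ h)
        in same-germ (c J.∘ (a J.∘ f)) (c J.∘ (b J.∘ h′)) (begin
          F₁ (c J.∘ (a J.∘ f)) ∘ g             ≈⟨ pushˡ homomorphism ⟩
          F₁ c ∘ (F₁ (a J.∘ f) ∘ g)            ≈⟨ refl⟩∘⟨ pushˡ homomorphism ⟩
          F₁ c ∘ (F₁ a ∘ (F₁ f ∘ g))           ≈⟨ refl⟩∘⟨ refl⟩∘⟨ p ⟩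
          F₁ c ∘ (F₁ a ∘ (F₁ f′ ∘ g′))         ≈⟨ refl⟩∘⟨ pullˡ (sym homomorphism) ⟩
          F₁ c ∘ (F₁ (a J.∘ f′) ∘ g′)          ≈⟨ extendʳ (F-commute r) ⟩
          F₁ c ∘ (F₁ (b J.∘ h) ∘ g′)           ≈⟨ refl⟩∘⟨ pushˡ homomorphism ⟩
          F₁ c ∘ (F₁ b ∘ (F₁ h ∘ g′))          ≈⟨ refl⟩∘⟨ refl⟩∘⟨ q ⟩
          F₁ c ∘ (F₁ b ∘ (F₁ h′ ∘ g″))         ≈⟨ refl⟩∘⟨ pullˡ (sym homomorphism) ⟩
          F₁ c ∘ (F₁ (b J.∘ h′) ∘ g″)          ≈⟨ pullˡ (sym homomorphism) ⟩
          F₁ (c J.∘ (b J.∘ h′)) ∘ g″           ∎)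

    module _ {C : Obj} {ι : ∀ j → F₀ j ⇒ C} (isC : IsColimit 𝒜 J F₀ F₁ C ι) where
      open IsColimit isC

      preserves⇒factors : HomPreservesColimit 𝒜 X J D C ι → HomFactors X D ι
      preserves⇒factors preserves = record
        { factor = λ h → let (j , g) = germ h in j , g , ι-germ h
        ; merge  = merge
        }
        where
        germ-map : Σ ((X ⇒ C) → Setoid.Carrier germs) _
        germ-map = preserves germs (λ j g → j , g)
          (λ j p → same-germ J.id J.id (refl⟩∘⟨ p))
          (λ f g → same-germ J.id f (elimˡ identity))

        germ : X ⇒ C → Setoid.Carrier germs
        germ = proj₁ germ-map

        ι-germ : ∀ h → ι (proj₁ (germ h)) ∘ proj₂ (germ h) ≈ h
        ι-germ h =
          -- A second test, on 𝒜(X, C) itself: sending h to its germ followed by the injection, and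
          -- sending h to h, both extend the same cocone, so they agree.
          let (_ , _ , _ , uniq) = preserves (hom-setoid X C) (λ j g → ι j ∘ g)
                                     (λ j → refl⟩∘⟨_) (λ f g → pullˡ (commute f))
          in trans (uniq (λ h′ → ι (proj₁ (germ h′)) ∘ proj₂ (germ h′))
                         (λ p → ι-resp (proj₁ (proj₂ germ-map) p))
                         (λ j g → ι-resp (proj₁ (proj₂ (proj₂ germ-map)) j g)) h)
                   (sym (uniq (λ h′ → h′) (λ p → p) (λ _ _ → refl) h))
          where
          ι-resp : ∀ {x y} → SameGerm x y → ι (proj₁ x) ∘ proj₂ x ≈ ι (proj₁ y) ∘ proj₂ y
          ι-resp (same-germ f f′ p) =
            trans (pushˡ (sym (commute f))) (trans (refl⟩∘⟨ p) (pullˡ (commute f′)))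

        merge : ∀ {j} (g g′ : X ⇒ F₀ j) → ι j ∘ g ≈ ι j ∘ g′ →
                Σ J.Obj λ k → Σ (j J.⇒ k) λ f → F₁ f ∘ g ≈ F₁ f ∘ g′
        merge {j} g g′ p =
          let (_ , resp , on-ι , _) = germ-map
              open Setoid germs using () renaming (trans to _⟫_; sym to inv)
              same-germ f f′ q = (inv (on-ι j g) ⟫ resp p) ⟫ on-ι j g′
              -- Equality of germs allows different legs `f` and `f′` out of `j`, whereas merging
              -- asks for a single one.
              (k , c , r) = equalise f f′
          in k , c J.∘ f , (begin
            F₁ (c J.∘ f) ∘ g     ≈⟨ pushˡ homomorphism ⟩
            F₁ c ∘ (F₁ f ∘ g)    ≈⟨ refl⟩∘⟨ q ⟩
            F₁ c ∘ (F₁ f′ ∘ g′)  ≈⟨ extendʳ (F-commute (IsEquivalence.sym J.equiv r)) ⟩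
            F₁ c ∘ (F₁ f ∘ g′)   ≈⟨ pullˡ (sym homomorphism) ⟩
            F₁ (c J.∘ f) ∘ g′    ∎)

      factors⇒preserves : HomFactors X D ι → HomPreservesColimit 𝒜 X J D C ι
      factors⇒preserves fac S κ κ-resp κ-natural =
        (λ h → let (j , g , _) = factor h in κ j g) ,
        (λ {h} {h′} p → let (_ , _ , q) = factor h ; (_ , _ , q′) = factor h′
                        in same (trans q (trans p (sym q′)))) ,
        (λ j g → let (_ , _ , q) = factor (ι j ∘ g) in same q) ,
        λ u′ u′-resp u′-on h → let (j , g , q) = factor h
                               in S.trans (u′-resp (sym q)) (u′-on j g)
        where
        open HomFactors fac
        module S = Setoid S

        same : ∀ {j j′} {g : X ⇒ F₀ j} {g′ : X ⇒ F₀ j′} → ι j ∘ g ≈ ι j′ ∘ g′ → κ j g S.≈ κ j′ g′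
        same {j} {j′} {g} {g′} p =
          let (k , f , f′) = upper j j′
              (l , c , q) = merge (F₁ f ∘ g) (F₁ f′ ∘ g′)
                              (trans (pullˡ (commute f)) (trans p (sym (pullˡ (commute f′)))))
          in S.trans (S.sym (S.trans (κ-natural c _) (κ-natural f g)))
             (S.trans (κ-resp l q) (S.trans (κ-natural c _) (κ-natural f′ g′)))

  Factoring : Obj → Set (o ⊔ Level.suc ℓ)
  Factoring X = ∀ {J} → Filtered J → (D : Functor J 𝒜) →
                ∀ {C ι} → IsColimit 𝒜 J (Functor.F₀ D) (Functor.F₁ D) C ι → HomFactors X D ι

  abstract
    fp⇒factors : ∀ {X} → IsFP 𝒜 X → Factoring X
    fp⇒factors p filt D isC = preserves⇒factors filt D isC (p _ filt D _ _ isC)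

    factoring⇒fp : ∀ {X} → Factoring X → IsFP 𝒜 X
    factoring⇒fp fac J filt D C ι isC = factors⇒preserves filt D isC (fac filt D isC)

  record Coequalizer {X Y} (f g : X ⇒ Y) : Set (o ⊔ ℓ) where
    field
      {target}   : Obj
      arrow      : Y ⇒ target
      equality   : arrow ∘ f ≈ arrow ∘ g
      coequalize : ∀ {B} (h : Y ⇒ B) → h ∘ f ≈ h ∘ g → Σ (target ⇒ B) λ u → u ∘ arrow ≈ h
      epic       : ∀ {B} {u v : target ⇒ B} → u ∘ arrow ≈ v ∘ arrow → u ≈ v

  module _ {X Y} {f g : X ⇒ Y} (q : Coequalizer f g) where
    open Coequalizer q

    -- A map out of the coequalizer restricts to Y and factors there at some stage, but may
    -- coequalize `f` and `g` only after the colimit injection. Merging over X moves this to a later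
    -- stage, where the factor descends to the coequalizer.
    factors-coequalizer : ∀ {J} (D : Functor J 𝒜) {C} {ι : ∀ j → Functor.F₀ D j ⇒ C} →
                          IsColimit 𝒜 J (Functor.F₀ D) (Functor.F₁ D) C ι →
                          HomFactors X D ι → HomFactors Y D ι → HomFactors target D ι
    factors-coequalizer {J} D {C} {ι} isC FX FY = record { factor = factor ; merge = merge }
      where
      open Functor D
      open IsColimit isC

      factor : (h : target ⇒ C) → Σ (Category.Obj J) λ j → Σ (target ⇒ F₀ j) λ u → ι j ∘ u ≈ h
      factor h with HomFactors.factor FY (h ∘ arrow)
      ... | j , y , r with HomFactors.merge FX (y ∘ f) (y ∘ g) (begin
              ι j ∘ (y ∘ f)    ≈⟨ pullˡ r ⟩
              (h ∘ arrow) ∘ f  ≈⟨ pullʳ equality ⟩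
              h ∘ (arrow ∘ g)  ≈⟨ sym assoc ⟩
              (h ∘ arrow) ∘ g  ≈⟨ pushˡ (sym r) ⟩
              ι j ∘ (y ∘ g)    ∎)
      ... | k , c , s with coequalize (F₁ c ∘ y) (trans assoc (trans s (sym assoc)))
      ... | u , t = k , u , epic (trans (pullʳ t) (trans (pullˡ (commute c)) r))

      merge : ∀ {j} (u v : target ⇒ F₀ j) → ι j ∘ u ≈ ι j ∘ v →
              Σ (Category.Obj J) λ k → Σ (Category._⇒_ J j k) λ c → F₁ c ∘ u ≈ F₁ c ∘ v
      merge u v r with HomFactors.merge FY (u ∘ arrow) (v ∘ arrow) (trans (pullˡ r) assoc)
      ... | k , c , s = k , c , epic (trans assoc (trans s (sym assoc)))

    fp-coequalizer : IsFP 𝒜 X → IsFP 𝒜 Y → IsFP 𝒜 target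
    fp-coequalizer p p′ = factoring⇒fp λ filt D isC →
      factors-coequalizer D isC (fp⇒factors p filt D isC) (fp⇒factors p′ filt D isC)

  data Endpoint : Set ℓ where
    source target : Endpoint

  data Parallel : Endpoint → Endpoint → Set ℓ where
    stay        : ∀ {x} → Parallel x x
    first second : Parallel source target

  parallel-pair : SmallCat 𝒜
  parallel-pair = record
    { Obj = Endpoint
    ; _⇒_ = Parallel
    ; _≈_ = _≡_
    ; id  = stay
    ; _∘_ = compose
    ; equiv = ≡.isEquivalence
    ; assoc = λ {_} {_} {_} {_} {f} {g} {h} → compose-assoc f g h
    ; identityˡ = ≡.refl
    ; identityʳ = λ {_} {_} {f} → compose-identityʳ f
    ; ∘-resp-≈ = ≡.cong₂ compose
    }
    where
    compose : ∀ {x y z} → Parallel y z → Parallel x y → Parallel x z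
    compose stay   f    = f
    compose first  stay = first
    compose second stay = second

    compose-identityʳ : ∀ {x y} (f : Parallel x y) → compose f stay ≡ f
    compose-identityʳ stay   = ≡.refl
    compose-identityʳ first  = ≡.refl
    compose-identityʳ second = ≡.refl

    compose-assoc : ∀ {w x y z} (f : Parallel w x) (g : Parallel x y) (h : Parallel y z) →
                    compose (compose h g) f ≡ compose h (compose g f)
    compose-assoc f    g    stay   = ≡.refl
    compose-assoc stay stay first  = ≡.refl
    compose-assoc stay stay second = ≡.refl

  coequalizer : Cocomplete 𝒜 → ∀ {X Y} (f g : X ⇒ Y) → Coequalizer f g
  coequalizer cocomplete {X} {Y} f g =
    let (C , ι , isC) = cocomplete parallel-pair pair
        open IsColimit isC
    in record
      { arrow = ι target
      ; equality = trans (commute first) (sym (commute second))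
      ; coequalize = λ {B} h r →
          let (u , on-ι , _) = universal B (λ { source → h ∘ f ; target → h })
                                 (λ { (stay {source}) → identityʳ ; (stay {target}) → identityʳ
                                    ; first → refl ; second → sym r })
          in u , on-ι target
      ; epic = λ r → colimit-ext isC λ
          { source → trans (refl⟩∘⟨ sym (commute first))
                       (trans (trans (sym assoc) (trans (r ⟩∘⟨refl) assoc)) (refl⟩∘⟨ commute first))
          ; target → r }
      }
    where
    pair : Functor parallel-pair 𝒜
    pair = record
      { F₀ = λ { source → X ; target → Y }
      ; F₁ = λ { (stay {source}) → id ; (stay {target}) → id ; first → f ; second → g }
      ; identity = λ { {source} → refl ; {target} → refl }
      ; homomorphism = λ
          { {source} {source} {_} {stay} {stay} → sym identityˡ
          ; {target} {target} {_} {stay} {stay} → sym identityˡ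
          ; {_} {_} {_} {first} {stay} → sym identityˡ
          ; {_} {_} {_} {second} {stay} → sym identityˡ
          ; {_} {_} {_} {stay} {first} → sym identityʳ
          ; {_} {_} {_} {stay} {second} → sym identityʳ }
      ; F-resp-≈ = λ { ≡.refl → refl }
      }

-- Coproducts of filtered diagrams and of finitely presentable objects

module FilteredCoproducts {o ℓ} {𝒜 : Category o ℓ ℓ} (cp : BinaryCoproducts 𝒜) where
  open Category 𝒜
  open Morphisms 𝒜
  open FilteredColimits 𝒜
  open BinaryCoproducts cp
  open Coproducts cp

  module _ {J : SmallCat 𝒜} where
    private
      module J = Category J

    constant : Obj → Functor J 𝒜
    constant A = record
      { F₀ = λ _ → A ; F₁ = λ _ → id ; identity = refl
      ; homomorphism = sym identityˡ ; F-resp-≈ = λ _ → refl }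

    _⊞_ : Functor J 𝒜 → Functor J 𝒜 → Functor J 𝒜
    D ⊞ E = record
      { F₀ = λ j → D.F₀ j + E.F₀ j
      ; F₁ = λ f → D.F₁ f +₁ E.F₁ f
      ; identity = trans (+₁-cong D.identity E.identity) +₁-identity
      ; homomorphism = trans (+₁-cong D.homomorphism E.homomorphism) (sym +₁∘+₁)
      ; F-resp-≈ = λ p → +₁-cong (D.F-resp-≈ p) (E.F-resp-≈ p)
      }
      where
      module D = Functor D
      module E = Functor E

    -- Upper bounds make the index category connected, so a cocone on a constant diagram has all its
    -- components equal.
    constant-colimit : Filtered J → ∀ A → IsColimit 𝒜 J (λ _ → A) (λ _ → id) A (λ _ → id)
    constant-colimit filt A = record
      { commute = λ _ → identityˡ
      ; universal = λ B κ κ-commute →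
          κ inhabited ,
          (λ j → let (k , f , g) = upper inhabited j in
                 trans identityʳ (trans (sym (κ-commute f)) (κ-commute g))) ,
          λ u p → trans (sym identityʳ) (p inhabited)
      }
      where open Filtered filt

    +-colimit : ∀ {D₀ E₀ : J.Obj → Obj} {D₁ : ∀ {i j} → i J.⇒ j → D₀ i ⇒ D₀ j}
                  {E₁ : ∀ {i j} → i J.⇒ j → E₀ i ⇒ E₀ j} {C B ι κ} →
                IsColimit 𝒜 J D₀ D₁ C ι → IsColimit 𝒜 J E₀ E₁ B κ →
                IsColimit 𝒜 J (λ j → D₀ j + E₀ j) (λ f → D₁ f +₁ E₁ f) (C + B) (λ j → ι j +₁ κ j)
    +-colimit isC isB = record
      { commute = λ f → trans +₁∘+₁ (+₁-cong (C.commute f) (B.commute f))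
      ; universal = λ Z τ τ-commute →
          let (u , u-on , _) = C.universal Z (λ j → τ j ∘ inl)
                (λ f → trans (pullʳ (sym +₁∘inl)) (pullˡ (τ-commute f)))
              (v , v-on , _) = B.universal Z (λ j → τ j ∘ inr)
                (λ f → trans (pullʳ (sym +₁∘inr)) (pullˡ (τ-commute f)))
          in [ u , v ] ,
             (λ j → trans []∘+₁ (trans ([]-cong (u-on j) (v-on j)) (sym (unique refl refl)))) ,
             λ w w-on → unique
               (colimit-ext isC λ j →
                 trans (pullʳ (sym +₁∘inl)) (trans (pullˡ (w-on j)) (sym (u-on j))))
               (colimit-ext isB λ j →
                 trans (pullʳ (sym +₁∘inr)) (trans (pullˡ (w-on j)) (sym (v-on j))))
      }
      where
      module C = IsColimit isC
      module B = IsColimit isB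

  module _ {X Y} {J} (filt : Filtered J) (D : Functor J 𝒜) {C} {ι : ∀ j → Functor.F₀ D j ⇒ C}
           (isC : IsColimit 𝒜 J (Functor.F₀ D) (Functor.F₁ D) C ι)
           (FX : HomFactors X D ι) (FY : HomFactors Y D ι) where
    open Functor D
    open IsColimit isC
    open Filtered filt

    factors-+ : HomFactors (X + Y) D ι
    factors-+ = record { factor = factor ; merge = merge }
      where
      factor : (h : X + Y ⇒ C) → Σ (Category.Obj J) λ j → Σ (X + Y ⇒ F₀ j) λ g → ι j ∘ g ≈ h
      factor h with HomFactors.factor FX (h ∘ inl) | HomFactors.factor FY (h ∘ inr)
      ... | i , x , p | j , y , q with upper i j
      ... | k , f , g = k , [ F₁ f ∘ x , F₁ g ∘ y ] ,
        +-ext (trans (pullʳ inject₁) (trans (pullˡ (commute f)) p))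
              (trans (pullʳ inject₂) (trans (pullˡ (commute g)) q))

      merge : ∀ {j} (g g′ : X + Y ⇒ F₀ j) → ι j ∘ g ≈ ι j ∘ g′ →
              Σ (Category.Obj J) λ k → Σ (Category._⇒_ J j k) λ f → F₁ f ∘ g ≈ F₁ f ∘ g′
      merge {j} g g′ p with HomFactors.merge FX (g ∘ inl) (g′ ∘ inl) (trans (pullˡ p) assoc)
      ... | k , f , q with HomFactors.merge FY (F₁ f ∘ (g ∘ inr)) (F₁ f ∘ (g′ ∘ inr)) (begin
              ι k ∘ (F₁ f ∘ (g ∘ inr))   ≈⟨ pullˡ (commute f) ⟩
              ι j ∘ (g ∘ inr)            ≈⟨ extendʳ p ⟩
              ι j ∘ (g′ ∘ inr)           ≈⟨ pushˡ (sym (commute f)) ⟩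
              ι k ∘ (F₁ f ∘ (g′ ∘ inr))  ∎)
      ... | l , f′ , r = l , Category._∘_ J f′ f , +-ext
        (begin
          (F₁ _ ∘ g) ∘ inl              ≈⟨ assoc ⟩
          F₁ _ ∘ (g ∘ inl)              ≈⟨ pushˡ homomorphism ⟩
          F₁ f′ ∘ (F₁ f ∘ (g ∘ inl))    ≈⟨ refl⟩∘⟨ q ⟩
          F₁ f′ ∘ (F₁ f ∘ (g′ ∘ inl))   ≈⟨ pullˡ (sym homomorphism) ⟩
          F₁ _ ∘ (g′ ∘ inl)             ≈⟨ sym assoc ⟩
          (F₁ _ ∘ g′) ∘ inl             ∎)
        (begin
          (F₁ _ ∘ g) ∘ inr              ≈⟨ assoc ⟩
          F₁ _ ∘ (g ∘ inr)              ≈⟨ pushˡ homomorphism ⟩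
          F₁ f′ ∘ (F₁ f ∘ (g ∘ inr))    ≈⟨ r ⟩
          F₁ f′ ∘ (F₁ f ∘ (g′ ∘ inr))   ≈⟨ pullˡ (sym homomorphism) ⟩
          F₁ _ ∘ (g′ ∘ inr)             ≈⟨ sym assoc ⟩
          (F₁ _ ∘ g′) ∘ inr             ∎)

  abstract
    fp-+ : ∀ {X Y} → IsFP 𝒜 X → IsFP 𝒜 Y → IsFP 𝒜 (X + Y)
    fp-+ p q = factoring⇒fp λ filt D isC →
      factors-+ filt D isC (fp⇒factors p filt D isC) (fp⇒factors q filt D isC)

-- Generators, retracts, and gluing along finitely presentable objects

module LocallyPresentable {o ℓ} {𝒜 : Category o ℓ ℓ} (lfp : LFP 𝒜) where
  open Category 𝒜
  open Morphisms 𝒜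
  open FilteredColimits 𝒜
  open LFP lfp

  record Retract (X Z : Obj) : Set ℓ where
    field
      section         : X ⇒ Z
      retraction      : Z ⇒ X
      section-retract : retraction ∘ section ≈ id

  record GenColimit (A : Obj) : Set (o ⊔ Level.suc ℓ) where
    field
      {shape} : SmallCat 𝒜
      filt    : Filtered shape
      diagram : Functor shape 𝒜
      gens    : ∀ j → Σ Gen λ i → Functor.F₀ diagram j ≡ gen i
      ι       : ∀ j → Functor.F₀ diagram j ⇒ A
      colimit : IsColimit 𝒜 shape (Functor.F₀ diagram) (Functor.F₁ diagram) A ι

    diagram-fp : ∀ j → IsFP 𝒜 (Functor.F₀ diagram j)
    diagram-fp j = ≡.subst (IsFP 𝒜) (≡.sym (proj₂ (gens j))) (gen-fp (proj₁ (gens j)))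

  abstract
    gen-colimit : ∀ A → GenColimit A
    gen-colimit A = let (_ , filt , diagram , gens , ι , colimit) = dense A in record
      { filt = filt ; diagram = diagram ; gens = gens ; ι = ι ; colimit = colimit }

    -- The identity of X factors through a stage of the diagram of generators that presents X.
    fp-retract : ∀ {X} → IsFP 𝒜 X → Σ Gen λ i → Retract X (gen i)
    fp-retract {X} p =
      let (j , s , r) = factor id
          (i , q) = gens j
      in i , ≡.subst (Retract X) q (record { section = s ; retraction = ι j ; section-retract = r })
      where
      open GenColimit (gen-colimit X)
      open HomFactors (fp⇒factors p filt diagram colimit)

    fp-ext : ∀ {A B} {f g : A ⇒ B} →
             (∀ {P} → IsFP 𝒜 P → (t : P ⇒ A) → f ∘ t ≈ g ∘ t) → f ≈ g
    fp-ext {A} p = colimit-ext colimit λ j → p (diagram-fp j) (ι j)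
      where open GenColimit (gen-colimit A)

    fp-glue : ∀ {A B} (κ : ∀ {P} → IsFP 𝒜 P → P ⇒ A → P ⇒ B) →
              (∀ {P Q} (p : IsFP 𝒜 P) (q : IsFP 𝒜 Q) (m : P ⇒ Q) {t : P ⇒ A} {t′ : Q ⇒ A} →
                 t ≈ t′ ∘ m → κ p t ≈ κ q t′ ∘ m) →
              Σ (A ⇒ B) λ u → ∀ {P} (p : IsFP 𝒜 P) (t : P ⇒ A) → u ∘ t ≈ κ p t
    fp-glue {A} {B} κ natural =
      let (u , u-on , _) = IsColimit.universal colimit B (λ j → κ (diagram-fp j) (ι j))
            (λ f → sym (natural (diagram-fp _) (diagram-fp _) _ (sym (IsColimit.commute colimit f))))
      in u , λ p t →
        let (j , m , r) = HomFactors.factor (fp⇒factors p filt diagram colimit) t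
        in trans (refl⟩∘⟨ sym r) (trans (pullˡ (u-on j))
             (sym (natural p (diagram-fp j) m (sym r))))
      where open GenColimit (gen-colimit A)

-- The filtered category of flat equations and its colimit

module Equations {o ℓ} {𝒜 : Category o ℓ ℓ} (cp : BinaryCoproducts 𝒜) (H : Functor 𝒜 𝒜) where
  open Category 𝒜
  open Morphisms 𝒜
  open FilteredColimits 𝒜 hiding (source; target)
  open BinaryCoproducts cp
  open Coproducts cp
  open FilteredCoproducts cp
  open Functor H
  open Algebras cp H

  record Equation (A : Obj) : Set (o ⊔ Level.suc ℓ) where
    constructor equation
    field
      {vars} : Obj
      fp     : IsFP 𝒜 vars
      eqn    : vars ⇒ F₀ vars + A

  open Equation public

  H+ : ∀ {X Y A} → X ⇒ Y → F₀ X + A ⇒ F₀ Y + A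
  H+ h = F₁ h +₁ id

  H+-cong : ∀ {X Y A} {h k : X ⇒ Y} → h ≈ k → H+ {A = A} h ≈ H+ k
  H+-cong p = +₁-cong (F-resp-≈ p) refl

  H+-identity : ∀ {X A} → H+ {A = A} (id {X}) ≈ id
  H+-identity = trans (+₁-cong identity refl) +₁-identity

  H+-∘ : ∀ {X Y Z A} {h : X ⇒ Y} {k : Y ⇒ Z} → H+ {A = A} (k ∘ h) ≈ H+ k ∘ H+ h
  H+-∘ = trans (+₁-cong homomorphism (sym identityˡ)) (sym +₁∘+₁)

  -- These are the coalgebra morphisms for H(-) + A, the maps in the functoriality axiom of an Elgot
  -- algebra.
  infix 4 _⇛_
  record _⇛_ {A : Obj} (e f : Equation A) : Set ℓ where
    field
      arrow    : vars e ⇒ vars f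
      commutes : H+ arrow ∘ eqn e ≈ eqn f ∘ arrow

  open _⇛_ public

  idₑ : ∀ {A} {e : Equation A} → e ⇛ e
  idₑ = record { arrow = id ; commutes = trans (elimˡ H+-identity) (sym identityʳ) }

  infixr 9 _∘ₑ_
  _∘ₑ_ : ∀ {A} {e f g : Equation A} → f ⇛ g → e ⇛ f → e ⇛ g
  k ∘ₑ h = record
    { arrow = arrow k ∘ arrow h
    ; commutes = trans (pushˡ H+-∘) (trans (refl⟩∘⟨ commutes h) (extendʳ (commutes k)))
    }

  _⊎ₑ_ : ∀ {A} → Equation A → Equation A → Equation A
  e ⊎ₑ f = equation (fp-+ (fp e) (fp f)) [ H+ inl ∘ eqn e , H+ inr ∘ eqn f ]

  inlₑ : ∀ {A} {e f : Equation A} → e ⇛ e ⊎ₑ f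
  inlₑ = record { arrow = inl ; commutes = sym inject₁ }

  inrₑ : ∀ {A} {e f : Equation A} → f ⇛ e ⊎ₑ f
  inrₑ = record { arrow = inr ; commutes = sym inject₂ }

  Functorial : ∀ {A B} → ((e : Equation A) → vars e ⇒ B) → Set (o ⊔ Level.suc ℓ)
  Functorial {A} κ = ∀ {e f : Equation A} (h : e ⇛ f) → κ f ∘ arrow h ≈ κ e

  -- All finitary equations appear here, although C is built from those on generators. The fields
  -- for `H+` say that F₀ C + A is again a filtered colimit, which is where finitarity of H enters.
  record EquationColimit (A : Obj) : Set (o ⊔ Level.suc ℓ) where
    field
      apex      : Obj
      c         : (e : Equation A) → vars e ⇒ apex
      c-functorial : Functorial c
      universal : ∀ {B} (κ : (e : Equation A) → vars e ⇒ B) → Functorial κ →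
                  Σ (apex ⇒ B) λ u → ∀ e → u ∘ c e ≈ κ e
      c-ext     : ∀ {B} {u v : apex ⇒ B} → (∀ e → u ∘ c e ≈ v ∘ c e) → u ≈ v
      factor    : ∀ {X} → IsFP 𝒜 X → (t : X ⇒ apex) →
                  Σ (Equation A) λ f → Σ (X ⇒ vars f) λ t′ → c f ∘ t′ ≈ t
      factor-+  : ∀ {X B} → IsFP 𝒜 X → (t : X ⇒ B + apex) →
                  Σ (Equation A) λ f → Σ (X ⇒ B + vars f) λ t′ → (id +₁ c f) ∘ t′ ≈ t
      factor-H+ : ∀ {X} → IsFP 𝒜 X → (t : X ⇒ F₀ apex + A) →
                  Σ (Equation A) λ f → Σ (X ⇒ F₀ (vars f) + A) λ t′ → H+ (c f) ∘ t′ ≈ t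
      merge-H+  : ∀ {X} → IsFP 𝒜 X → ∀ {f} {t t′ : X ⇒ F₀ (vars f) + A} →
                  H+ (c f) ∘ t ≈ H+ (c f) ∘ t′ →
                  Σ (Equation A) λ g → Σ (f ⇛ g) λ h → H+ (arrow h) ∘ t ≈ H+ (arrow h) ∘ t′

  module _ (lfp : LFP 𝒜) (finitary : Finitary 𝒜 H) (A : Obj) where
    open LFP lfp
    open LocallyPresentable lfp

    GenEquation : Set ℓ
    GenEquation = Σ Gen λ i → gen i ⇒ F₀ (gen i) + A

    ⌊_⌋ : GenEquation → Equation A
    ⌊ i , e ⌋ = equation (gen-fp i) e

    gen-equations : SmallCat 𝒜
    gen-equations = record
      { Obj = GenEquation
      ; _⇒_ = λ e f → ⌊ e ⌋ ⇛ ⌊ f ⌋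
      ; _≈_ = λ h k → arrow h ≈ arrow k
      ; id = idₑ
      ; _∘_ = _∘ₑ_
      ; equiv = record { refl = refl ; sym = sym ; trans = trans }
      ; assoc = assoc
      ; identityˡ = identityˡ
      ; identityʳ = identityʳ
      ; ∘-resp-≈ = ∘-resp-≈
      }

    -- Retracts replace closure of the generators under finite colimits, which LFP does not give.
    record EquationRetract (e : Equation A) : Set (o ⊔ Level.suc ℓ) where
      field
        target          : GenEquation
        section         : e ⇛ ⌊ target ⌋
        retraction      : ⌊ target ⌋ ⇛ e
        section-retract : arrow retraction ∘ arrow section ≈ id

    abstract
      -- Conjugating the equation by the retract onto a generator makes both the section and the
      -- retraction equation morphisms.
      equation-retract : ∀ e → EquationRetract e
      equation-retract e =
        let (i , r) = fp-retract (fp e) in transfer i r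
        where
        transfer : ∀ i → Retract (vars e) (gen i) → EquationRetract e
        transfer i r = record
          { target = i , H+ section ∘ (eqn e ∘ retraction)
          ; section = record { arrow = section ; commutes = sym (pullʳ (cancelʳ section-retract)) }
          ; retraction = record { arrow = retraction
                                ; commutes = cancelˡ (trans (sym H+-∘) (trans (H+-cong section-retract) H+-identity)) }
          ; section-retract = section-retract
          }
          where open Retract r

      equation-upper : (e f : Equation A) → Σ GenEquation λ g → (e ⇛ ⌊ g ⌋) × (f ⇛ ⌊ g ⌋)
      equation-upper e f = target , section ∘ₑ inlₑ {f = f} , section ∘ₑ inrₑ {e = e}
        where open EquationRetract (equation-retract (e ⊎ₑ f))

      -- Colimits of coalgebras are formed on carriers: the coequalizer of the underlying arrows
      -- inherits an equation, and its variables are still finitely presentable.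
      equation-equalise : {e f : Equation A} (h k : e ⇛ f) →
        Σ GenEquation λ g → Σ (f ⇛ ⌊ g ⌋) λ q → arrow q ∘ arrow h ≈ arrow q ∘ arrow k
      equation-equalise {e} {f} h k =
        target , section ∘ₑ quotient-map , trans (pullʳ Q.equality) (sym assoc)
        where
        module Q = Coequalizer (coequalizer cocomplete (arrow h) (arrow k))

        step : ∀ (l : e ⇛ f) → (H+ Q.arrow ∘ eqn f) ∘ arrow l ≈ H+ (Q.arrow ∘ arrow l) ∘ eqn e
        step l = trans (pullʳ (sym (commutes l))) (pullˡ (sym H+-∘))

        induced : Σ (Q.target ⇒ F₀ Q.target + A) λ u → u ∘ Q.arrow ≈ H+ Q.arrow ∘ eqn f
        induced = Q.coequalize (H+ Q.arrow ∘ eqn f)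
          (trans (step h) (trans (H+-cong Q.equality ⟩∘⟨refl) (sym (step k))))

        quotient : Equation A
        quotient = equation (fp-coequalizer (coequalizer cocomplete (arrow h) (arrow k)) (fp e) (fp f))
                            (proj₁ induced)

        quotient-map : f ⇛ quotient
        quotient-map = record { arrow = Q.arrow ; commutes = sym (proj₂ induced) }

        open EquationRetract (equation-retract quotient)

      gen-equations-filtered : Filtered gen-equations
      gen-equations-filtered = record
        -- A stage of the diagram presenting A supplies a map into A, read as an equation whose
        -- right-hand sides are all parameters.
        { inhabited = let (i , r) = fp-retract (diagram-fp inhabited)
                      in i , inr ∘ (ι inhabited ∘ Retract.retraction r)
        ; upper = λ e f → equation-upper ⌊ e ⌋ ⌊ f ⌋
        ; equalise = equation-equalise
        }
        where
        open GenColimit (gen-colimit A)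
        open Filtered filt using (inhabited)

    variables-diagram : Functor gen-equations 𝒜
    variables-diagram = record
      { F₀ = λ e → vars ⌊ e ⌋ ; F₁ = arrow ; identity = refl
      ; homomorphism = refl ; F-resp-≈ = λ p → p }

    H-diagram : Functor gen-equations 𝒜
    H-diagram = record
      { F₀ = λ e → F₀ (vars ⌊ e ⌋) ; F₁ = λ h → F₁ (arrow h) ; identity = identity
      ; homomorphism = homomorphism ; F-resp-≈ = F-resp-≈ }

    module _ (C : Obj) (ι : ∀ e → vars ⌊ e ⌋ ⇒ C)
             (isC : IsColimit 𝒜 gen-equations (λ e → vars ⌊ e ⌋) arrow C ι) where
      private
        module C = IsColimit isC
        module Ret (e : Equation A) = EquationRetract (equation-retract e)

        inj : (e : Equation A) → vars e ⇒ C
        inj e = ι (Ret.target e) ∘ arrow (Ret.section e)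

        -- Inserting retraction and section of `e` turns `h` into a morphism between equations on
        -- generators, where the colimit cocone applies.
        inj-functorial : Functorial inj
        inj-functorial {e} {f} h = begin
          (ι _ ∘ arrow (Ret.section f)) ∘ arrow h
            ≈⟨ sym (cancelʳ (Ret.section-retract e)) ⟩
          (((ι _ ∘ arrow (Ret.section f)) ∘ arrow h) ∘ arrow (Ret.retraction e)) ∘ arrow (Ret.section e)
            ≈⟨ trans assoc assoc ⟩∘⟨refl ⟩
          (ι _ ∘ (arrow (Ret.section f) ∘ (arrow h ∘ arrow (Ret.retraction e)))) ∘ arrow (Ret.section e)
            ≈⟨ C.commute (Ret.section f ∘ₑ (h ∘ₑ Ret.retraction e)) ⟩∘⟨refl ⟩
          ι _ ∘ arrow (Ret.section e) ∎

        inj-ι : ∀ e → inj ⌊ e ⌋ ≈ ι e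
        inj-ι e = C.commute (Ret.section ⌊ e ⌋)

        H-colimit = finitary gen-equations gen-equations-filtered variables-diagram C ι isC
        constant-A = constant-colimit gen-equations-filtered A

        H+-diagram : Functor gen-equations 𝒜
        H+-diagram = H-diagram ⊞ constant A

        H+-colimit : IsColimit 𝒜 gen-equations (Functor.F₀ H+-diagram) (Functor.F₁ H+-diagram)
                       (F₀ C + A) (λ e → H+ (ι e))
        H+-colimit = +-colimit H-colimit constant-A

        +C-colimit : ∀ B → IsColimit 𝒜 gen-equations (λ e → B + vars ⌊ e ⌋) (λ h → id +₁ arrow h)
                             (B + C) (λ e → id +₁ ι e)
        +C-colimit B = +-colimit (constant-colimit gen-equations-filtered B) isC

        merge : ∀ {X} → IsFP 𝒜 X → ∀ {f} {t t′ : X ⇒ F₀ (vars f) + A} →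
                  H+ (inj f) ∘ t ≈ H+ (inj f) ∘ t′ →
                  Σ (Equation A) λ g → Σ (f ⇛ g) λ h → H+ (arrow h) ∘ t ≈ H+ (arrow h) ∘ t′
        merge p {f} {t} {t′} r
          with HomFactors.merge (fp⇒factors p gen-equations-filtered H+-diagram H+-colimit)
                 (H+ (arrow (Ret.section f)) ∘ t) (H+ (arrow (Ret.section f)) ∘ t′)
                 (trans (pullˡ (sym H+-∘)) (trans r (pushˡ H+-∘)))
        ... | g , h , q = ⌊ g ⌋ , h ∘ₑ Ret.section f ,
          trans (pushˡ H+-∘) (trans q (pullˡ (sym H+-∘)))

      colimit-of-equations : EquationColimit A
      colimit-of-equations = record
        { apex = C
        ; c = inj
        ; c-functorial = inj-functorial
        ; universal = λ κ κ-functorial →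
            let (u , u-on , _) = C.universal _ (λ e → κ ⌊ e ⌋) κ-functorial
            in u , λ e → trans (pullˡ (u-on (Ret.target e))) (κ-functorial (Ret.section e))
        ; c-ext = λ p → colimit-ext isC λ e →
            trans (refl⟩∘⟨ sym (inj-ι e)) (trans (p ⌊ e ⌋) (refl⟩∘⟨ inj-ι e))
        ; factor = λ p t →
            let (f , t′ , r) = HomFactors.factor (fp⇒factors p gen-equations-filtered variables-diagram isC) t
            in ⌊ f ⌋ , t′ , trans (inj-ι f ⟩∘⟨refl) r
        ; factor-+ = λ {_} {B} p t →
            let (f , t′ , r) = HomFactors.factor
                  (fp⇒factors p gen-equations-filtered (constant B ⊞ variables-diagram) (+C-colimit B)) t
            in ⌊ f ⌋ , t′ , trans (+₁-cong refl (inj-ι f) ⟩∘⟨refl) r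
        ; factor-H+ = λ p t →
            let (f , t′ , r) = HomFactors.factor
                  (fp⇒factors p gen-equations-filtered H+-diagram H+-colimit) t
            in ⌊ f ⌋ , t′ , trans (H+-cong (inj-ι f) ⟩∘⟨refl) r
        ; merge-H+ = merge
        }

    abstract
      equation-colimit : EquationColimit A
      equation-colimit =
        let (C , ι , isC) = cocomplete gen-equations variables-diagram
        in colimit-of-equations C ι isC

-- Operations on equations, families of solutions, and iterativity of the colimit

module Solutions {o ℓ} {𝒜 : Category o ℓ ℓ} (cp : BinaryCoproducts 𝒜) (H : Functor 𝒜 𝒜) where
  open Category 𝒜
  open Morphisms 𝒜
  open BinaryCoproducts cp
  open Coproducts cp
  open FilteredCoproducts cp using (fp-+)
  open Functor H
  open Algebras cp H
  open Equations cp H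

  -- No right-hand side mentions the new variables X, so solving them means evaluating `t` once at a
  -- solution of `f`.
  attach : ∀ {X A} → IsFP 𝒜 X → (f : Equation A) → X ⇒ F₀ (vars f) + A → Equation A
  attach p f t = equation (fp-+ p (fp f)) (H+ inr ∘ [ t , eqn f ])

  attach-inr : ∀ {X A} (p : IsFP 𝒜 X) (f : Equation A) (t : X ⇒ F₀ (vars f) + A) →
               f ⇛ attach p f t
  attach-inr p f t = record { arrow = inr ; commutes = sym (pullʳ inject₂) }

  attach-map : ∀ {X Y A} (p : IsFP 𝒜 X) (q : IsFP 𝒜 Y) {f g : Equation A}
               {t : X ⇒ F₀ (vars f) + A} {t′ : Y ⇒ F₀ (vars g) + A} (m : X ⇒ Y) (h : f ⇛ g) →
               H+ (arrow h) ∘ t ≈ t′ ∘ m → attach p f t ⇛ attach q g t′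
  attach-map p q {f} {g} {t} {t′} m h r = record
    { arrow = m +₁ arrow h
    ; commutes = begin
        H+ (m +₁ arrow h) ∘ (H+ inr ∘ [ t , eqn f ])  ≈⟨ pullˡ (trans (sym H+-∘) (H+-cong +₁∘inr)) ⟩
        H+ (inr ∘ arrow h) ∘ [ t , eqn f ]            ≈⟨ pushˡ H+-∘ ⟩
        H+ inr ∘ (H+ (arrow h) ∘ [ t , eqn f ])       ≈⟨ refl⟩∘⟨ ∘[] ⟩
        H+ inr ∘ [ H+ (arrow h) ∘ t , H+ (arrow h) ∘ eqn f ]
                                                      ≈⟨ refl⟩∘⟨ []-cong r (commutes h) ⟩
        H+ inr ∘ [ t′ ∘ m , eqn g ∘ arrow h ]         ≈⟨ refl⟩∘⟨ sym []∘+₁ ⟩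
        H+ inr ∘ ([ t′ , eqn g ] ∘ (m +₁ arrow h))    ≈⟨ sym assoc ⟩
        (H+ inr ∘ [ t′ , eqn g ]) ∘ (m +₁ arrow h)    ∎
    }

  -- Unfolding an equation once and attaching the result only duplicates its variables; the
  -- codiagonal identifies the copies. This gives one half of the fixpoint isomorphism.
  attach-fold : ∀ {A} (e : Equation A) → attach (fp e) e (eqn e) ⇛ e
  attach-fold e = record
    { arrow = [ id , id ]
    ; commutes = begin
        H+ [ id , id ] ∘ (H+ inr ∘ [ eqn e , eqn e ])  ≈⟨ cancelˡ (trans (sym H+-∘) (trans (H+-cong inject₂) H+-identity)) ⟩
        [ eqn e , eqn e ]                              ≈⟨ []-cong (sym identityʳ) (sym identityʳ) ⟩
        [ eqn e ∘ id , eqn e ∘ id ]                    ≈⟨ sym ∘[] ⟩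
        eqn e ∘ [ id , id ]                            ∎
    }

  ⊕-[] : ∀ {X Y A} {f : Y ⇒ F₀ Y + A} {e : X ⇒ F₀ X + Y} →
         f ⊕ e ≈ [ inl ∘ F₁ inl , H+ inr ∘ f ] ∘ [ e , inr ]
  ⊕-[] {f = f} {e} = begin
    (can +₁ id) ∘ (assocˡ ∘ ((id +₁ f) ∘ [ e , inr ]))       ≈⟨ sym assoc ⟩
    ((can +₁ id) ∘ assocˡ) ∘ ((id +₁ f) ∘ [ e , inr ])       ≈⟨ regroup ⟩∘⟨refl ⟩
    [ inl ∘ F₁ inl , H+ inr ] ∘ ((id +₁ f) ∘ [ e , inr ])    ≈⟨ pullˡ []∘+₁ ⟩
    [ (inl ∘ F₁ inl) ∘ id , H+ inr ∘ f ] ∘ [ e , inr ]       ≈⟨ []-cong identityʳ refl ⟩∘⟨refl ⟩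
    [ inl ∘ F₁ inl , H+ inr ∘ f ] ∘ [ e , inr ]              ∎
    where
    regroup : ∀ {X Y A} → (can {X} {Y} +₁ id {A}) ∘ assocˡ ≈ [ inl ∘ F₁ inl , H+ inr ]
    regroup = unique
      (trans (pullʳ inject₁) (trans (pullˡ +₁∘inl) (pullʳ inject₁)))
      (trans (pullʳ inject₂) (trans ∘[] ([]-cong
        (trans (pullˡ +₁∘inl) (pullʳ inject₂)) +₁∘inr)))

  ⊕-inl : ∀ {X Y A} {f : Y ⇒ F₀ Y + A} {e : X ⇒ F₀ X + Y} →
          (f ⊕ e) ∘ inl ≈ [ inl ∘ F₁ inl , H+ inr ∘ f ] ∘ e
  ⊕-inl = trans (⊕-[] ⟩∘⟨refl) (pullʳ inject₁)

  ⊕-inr : ∀ {X Y A} {f : Y ⇒ F₀ Y + A} {e : X ⇒ F₀ X + Y} → (f ⊕ e) ∘ inr ≈ H+ inr ∘ f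
  ⊕-inr = trans (⊕-[] ⟩∘⟨refl) (trans (pullʳ inject₂) inject₂)

  sumₑ : ∀ {X A} (f : Equation A) → IsFP 𝒜 (X + vars f) → X ⇒ F₀ X + vars f → Equation A
  sumₑ f r e = equation r (eqn f ⊕ e)

  sumₑ-inr : ∀ {X A} (f : Equation A) (r : IsFP 𝒜 (X + vars f)) (e : X ⇒ F₀ X + vars f) →
             f ⇛ sumₑ f r e
  sumₑ-inr f r e = record { arrow = inr ; commutes = sym ⊕-inr }

  -- The hypothesis says that `x` solves `e` inside the coalgebra `g`: each variable unfolds as `e`
  -- prescribes, and a parameter unfolds as its image under `h`. Thus morphisms out of a ⊕-sum
  -- amount to a morphism on `f` together with such an internal solution.
  sumₑ-elim : ∀ {X A} {f g : Equation A} (r : IsFP 𝒜 (X + vars f)) {e : X ⇒ F₀ X + vars f}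
              (x : X ⇒ vars g) (h : f ⇛ g) →
              eqn g ∘ x ≈ [ inl ∘ F₁ x , eqn g ∘ arrow h ] ∘ e → sumₑ f r e ⇛ g
  sumₑ-elim {f = f} {g} r {e} x h p = record
    { arrow = [ x , arrow h ]
    ; commutes = +-ext
        (begin
          (H+ [ x , arrow h ] ∘ (eqn f ⊕ e)) ∘ inl              ≈⟨ pullʳ ⊕-inl ⟩
          H+ [ x , arrow h ] ∘ ([ inl ∘ F₁ inl , H+ inr ∘ eqn f ] ∘ e)
                                                                ≈⟨ pullˡ ∘[] ⟩
          [ H+ [ x , arrow h ] ∘ (inl ∘ F₁ inl) , H+ [ x , arrow h ] ∘ (H+ inr ∘ eqn f) ] ∘ e
            ≈⟨ []-cong (trans (pullˡ +₁∘inl) (pullʳ (trans (sym homomorphism) (F-resp-≈ inject₁))))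
                       on-f ⟩∘⟨refl ⟩
          [ inl ∘ F₁ x , eqn g ∘ arrow h ] ∘ e                  ≈⟨ sym p ⟩
          eqn g ∘ x                                             ≈⟨ sym (pullʳ inject₁) ⟩
          (eqn g ∘ [ x , arrow h ]) ∘ inl                       ∎)
        (trans (pullʳ ⊕-inr) (trans on-f (sym (pullʳ inject₂))))
    }
    where
    on-f : H+ [ x , arrow h ] ∘ (H+ inr ∘ eqn f) ≈ eqn g ∘ arrow h
    on-f = trans (pullˡ (trans (sym H+-∘) (H+-cong inject₂))) (commutes h)

  sumₑ-map : ∀ {X A} {f g : Equation A} (r : IsFP 𝒜 (X + vars f)) (r′ : IsFP 𝒜 (X + vars g))
             (e : X ⇒ F₀ X + vars f) (h : f ⇛ g) → sumₑ f r e ⇛ sumₑ g r′ (arrow h • e)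
  sumₑ-map {f = f} {g} r r′ e h = sumₑ-elim r inl (sumₑ-inr g r′ (arrow h • e) ∘ₑ h) (begin
    (eqn g ⊕ (arrow h • e)) ∘ inl                                      ≈⟨ ⊕-inl ⟩
    [ inl ∘ F₁ inl , H+ inr ∘ eqn g ] ∘ ((id +₁ arrow h) ∘ e)          ≈⟨ pullˡ []∘+₁ ⟩
    [ (inl ∘ F₁ inl) ∘ id , (H+ inr ∘ eqn g) ∘ arrow h ] ∘ e           ≈⟨ []-cong identityʳ
                                                  (trans (sym ⊕-inr ⟩∘⟨refl) assoc) ⟩∘⟨refl ⟩
    [ inl ∘ F₁ inl , (eqn g ⊕ (arrow h • e)) ∘ (inr ∘ arrow h) ] ∘ e   ∎)

  •-∘ : ∀ {X Y Z W} {h : Y ⇒ Z} {k : Z ⇒ W} {e : X ⇒ F₀ X + Y} → k • (h • e) ≈ (k ∘ h) • e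
  •-∘ = pullˡ (trans +₁∘+₁ (+₁-cong identityˡ refl))

  •-cong : ∀ {X Y Z} {h k : Y ⇒ Z} {e e′ : X ⇒ F₀ X + Y} → h ≈ k → e ≈ e′ → h • e ≈ k • e′
  •-cong p q = +₁-cong refl p ⟩∘⟨ q

  id-• : ∀ {X Y} {e : X ⇒ F₀ X + Y} → id • e ≈ e
  id-• = elimˡ +₁-identity

  -- Renaming parameters along `m` can be moved into the algebra, so equations over A can be solved
  -- in B against `[ α , m ]`.
  •-solution : ∀ {X A B} {α : F₀ B ⇒ B} {m : A ⇒ B} {s : X ⇒ B} {e : X ⇒ F₀ X + A} →
               [ α , id ] ∘ ((F₁ s +₁ id) ∘ (m • e)) ≈ [ α , m ] ∘ (H+ s ∘ e)
  •-solution = trans (pullˡ []∘+₁) (trans (pullˡ []∘+₁)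
    (trans ([]-cong identityʳ (trans (identityˡ ⟩∘⟨refl) (trans identityˡ (sym identityʳ))) ⟩∘⟨refl)
      (pushˡ (sym []∘+₁))))

  []-solution : ∀ {X A B} {α : F₀ B ⇒ B} {m : A ⇒ B} {s : X ⇒ B} {e : X ⇒ F₀ X + A} →
                [ α , id ] ∘ ((F₁ s +₁ id) ∘ (m • e)) ≈ [ α ∘ F₁ s , m ] ∘ e
  []-solution = trans •-solution (pullˡ (trans []∘+₁ ([]-cong refl identityʳ)))

  -- One notion covers the cocone of C with β = `construct`, the solutions in an iterative algebra
  -- with β = `[ β , m ]`, and the chosen solutions of an Elgot algebra with β = `[ α , id ]`.
  record SolutionFamily {A B : Obj} (β : F₀ B + A ⇒ B) : Set (o ⊔ Level.suc ℓ) where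
    field
      κ            : (e : Equation A) → vars e ⇒ B
      solves       : ∀ e → κ e ≈ β ∘ (H+ (κ e) ∘ eqn e)
      κ-functorial : Functorial κ

    -- The part of compositionality valid in every family: the ⊕-sum yields some solution of the
    -- composite equation. That it is the chosen one needs uniqueness or the Elgot axiom.
    solves-sum : ∀ {X} (f : Equation A) (r : IsFP 𝒜 (X + vars f)) (e : X ⇒ F₀ X + vars f) →
                 IsSolution (β ∘ inl) (κ f • e) (κ (sumₑ f r e) ∘ inl)
    solves-sum f r e = begin
      κ w ∘ inl                                                      ≈⟨ solves w ⟩∘⟨refl ⟩
      (β ∘ (H+ (κ w) ∘ eqn w)) ∘ inl                                 ≈⟨ trans (pullʳ (pullʳ ⊕-inl)) (sym assoc) ⟩
      (β ∘ H+ (κ w)) ∘ ([ inl ∘ F₁ inl , H+ inr ∘ eqn f ] ∘ e)       ≈⟨ pullˡ ∘[] ⟩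
      [ (β ∘ H+ (κ w)) ∘ (inl ∘ F₁ inl) , (β ∘ H+ (κ w)) ∘ (H+ inr ∘ eqn f) ] ∘ e
        ≈⟨ []-cong on-H on-f ⟩∘⟨refl ⟩
      [ (β ∘ inl) ∘ F₁ (κ w ∘ inl) , κ f ] ∘ e                       ≈⟨ sym []-solution ⟩
      [ β ∘ inl , id ] ∘ ((F₁ (κ w ∘ inl) +₁ id) ∘ (κ f • e))        ∎
      where
      w = sumₑ f r e

      on-H : (β ∘ H+ (κ w)) ∘ (inl ∘ F₁ inl) ≈ (β ∘ inl) ∘ F₁ (κ w ∘ inl)
      on-H = begin
        (β ∘ H+ (κ w)) ∘ (inl ∘ F₁ inl)   ≈⟨ pullʳ (extendʳ +₁∘inl) ⟩
        β ∘ (inl ∘ (F₁ (κ w) ∘ F₁ inl))   ≈⟨ sym assoc ⟩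
        (β ∘ inl) ∘ (F₁ (κ w) ∘ F₁ inl)   ≈⟨ refl⟩∘⟨ sym homomorphism ⟩
        (β ∘ inl) ∘ F₁ (κ w ∘ inl)        ∎

      on-f : (β ∘ H+ (κ w)) ∘ (H+ inr ∘ eqn f) ≈ κ f
      on-f = begin
        (β ∘ H+ (κ w)) ∘ (H+ inr ∘ eqn f)  ≈⟨ pullʳ (pullˡ (sym H+-∘)) ⟩
        β ∘ (H+ (κ w ∘ inr) ∘ eqn f)       ≈⟨ refl⟩∘⟨ H+-cong (κ-functorial (sumₑ-inr f r e)) ⟩∘⟨refl ⟩
        β ∘ (H+ (κ f) ∘ eqn f)             ≈⟨ sym (solves f) ⟩
        κ f                                ∎

  hom-solution : ∀ {X B B′} {β : F₀ B ⇒ B} {β′ : F₀ B′ ⇒ B′} {h : B ⇒ B′} {e : X ⇒ F₀ X + B} {s} →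
                 IsAlgHom β β′ h → IsSolution β e s → IsSolution β′ (h • e) (h ∘ s)
  hom-solution {β = β} {β′} {h} {e} {s} hom sol = begin
    h ∘ s                                              ≈⟨ refl⟩∘⟨ sol ⟩
    h ∘ ([ β , id ] ∘ ((F₁ s +₁ id) ∘ e))              ≈⟨ refl⟩∘⟨ pullˡ []∘+₁ ⟩
    h ∘ ([ β ∘ F₁ s , id ∘ id ] ∘ e)                   ≈⟨ pullˡ ∘[] ⟩
    [ h ∘ (β ∘ F₁ s) , h ∘ (id ∘ id) ] ∘ e             ≈⟨ []-cong
      (trans (extendʳ hom) (refl⟩∘⟨ sym homomorphism)) (elimʳ identityˡ) ⟩∘⟨refl ⟩
    [ β′ ∘ F₁ (h ∘ s) , h ] ∘ e                        ≈⟨ sym []-solution ⟩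
    [ β′ , id ] ∘ ((F₁ (h ∘ s) +₁ id) ∘ (h • e))       ∎

  module IterativeAlgebra {B : Obj} {β : F₀ B ⇒ B} (iterative : IsIterative B β) where
    solve : ∀ {X} → IsFP 𝒜 X → X ⇒ F₀ X + B → X ⇒ B
    solve p e = proj₁ (iterative _ p e)

    solve-solution : ∀ {X} (p : IsFP 𝒜 X) (e : X ⇒ F₀ X + B) → IsSolution β e (solve p e)
    solve-solution p e = proj₁ (proj₂ (iterative _ p e))

    solve-unique : ∀ {X} (p : IsFP 𝒜 X) {e e′ : X ⇒ F₀ X + B} {s} →
                   e ≈ e′ → IsSolution β e s → s ≈ solve p e′
    solve-unique p {e} {e′} {s} q sol =
      proj₂ (proj₂ (iterative _ p e′)) s (trans sol (refl⟩∘⟨ refl⟩∘⟨ q))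

    solve-cong : ∀ {X} (p q : IsFP 𝒜 X) {e e′ : X ⇒ F₀ X + B} → e ≈ e′ → solve p e ≈ solve q e′
    solve-cong p q r = solve-unique q r (solve-solution p _)

    solutions : ∀ {A} (m : A ⇒ B) → SolutionFamily [ β , m ]
    solutions m = record
      { κ = λ e → solve (fp e) (m • eqn e)
      ; solves = λ e → trans (solve-solution (fp e) _) •-solution
      ; κ-functorial = λ {e} {f} h → solve-unique (fp e) refl (begin
          solve (fp f) (m • eqn f) ∘ arrow h       ≈⟨ trans (solve-solution (fp f) _) •-solution ⟩∘⟨refl ⟩
          ([ β , m ] ∘ (H+ _ ∘ eqn f)) ∘ arrow h   ≈⟨ pullʳ (pullʳ (sym (commutes h))) ⟩
          [ β , m ] ∘ (H+ _ ∘ (H+ (arrow h) ∘ eqn e))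
                                                   ≈⟨ refl⟩∘⟨ pullˡ (sym H+-∘) ⟩
          [ β , m ] ∘ (H+ (_ ∘ arrow h) ∘ eqn e)   ≈⟨ sym •-solution ⟩
          [ β , id ] ∘ ((F₁ (_ ∘ arrow h) +₁ id) ∘ (m • eqn e)) ∎)
      }

  solve-hom : ∀ {B B′} {β : F₀ B ⇒ B} {β′ : F₀ B′ ⇒ B′} (it : IsIterative B β) (it′ : IsIterative B′ β′)
              {h : B ⇒ B′} → IsAlgHom β β′ h → ∀ {X} (p : IsFP 𝒜 X) (e : X ⇒ F₀ X + B) →
              h ∘ IterativeAlgebra.solve it p e ≈ IterativeAlgebra.solve it′ p (h • e)
  solve-hom it it′ hom p e = IterativeAlgebra.solve-unique it′ p refl
    (hom-solution hom (IterativeAlgebra.solve-solution it p e))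

  -- The colimit C is a fixpoint of H(-) + A: construct sends t : P → HY + A, taken over an
  -- equation f on Y, to the solution of the extra variables P in the joint equation on P + Y.
  module Fixpoint (lfp : LFP 𝒜) {A : Obj} (K : EquationColimit A) where
    open EquationColimit K renaming (apex to C)
    open LocallyPresentable lfp

    private
      destruct-map : Σ (C ⇒ F₀ C + A) λ u → ∀ e → u ∘ c e ≈ H+ (c e) ∘ eqn e
      destruct-map = universal (λ e → H+ (c e) ∘ eqn e) λ {e} {f} h →
        trans (pullʳ (sym (commutes h))) (trans (pullˡ (sym H+-∘)) (H+-cong (c-functorial h) ⟩∘⟨refl))

      -- A map into F₀ C + A has many factorisations through approximants. Two of them are compared
      -- over `f ⊎ₑ g`, become equal at a later `k`, and both joint equations then map to the one
      -- attached over `k`. This gives well-definedness and naturality of `construct` at once.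
      merge-attach : ∀ {P Q} (p : IsFP 𝒜 P) (q : IsFP 𝒜 Q) (m : P ⇒ Q) {f g : Equation A}
                     {t : P ⇒ F₀ (vars f) + A} {t′ : Q ⇒ F₀ (vars g) + A} →
                     H+ (c f) ∘ t ≈ (H+ (c g) ∘ t′) ∘ m →
                     c (attach p f t) ∘ inl ≈ (c (attach q g t′) ∘ inl) ∘ m
      merge-attach p q m {f} {g} {t} {t′} r
        with merge-H+ p {f ⊎ₑ g} {H+ inl ∘ t} {(H+ inr ∘ t′) ∘ m} (begin
               H+ (c (f ⊎ₑ g)) ∘ (H+ inl ∘ t)          ≈⟨ pullˡ (sym H+-∘) ⟩
               H+ (c (f ⊎ₑ g) ∘ inl) ∘ t               ≈⟨ H+-cong (c-functorial (inlₑ {f = g})) ⟩∘⟨refl ⟩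
               H+ (c f) ∘ t                            ≈⟨ r ⟩
               (H+ (c g) ∘ t′) ∘ m                     ≈⟨ (H+-cong (sym (c-functorial (inrₑ {e = f}))) ⟩∘⟨refl) ⟩∘⟨refl ⟩
               (H+ (c (f ⊎ₑ g) ∘ inr) ∘ t′) ∘ m        ≈⟨ trans (pushˡ H+-∘ ⟩∘⟨refl) assoc ⟩
               H+ (c (f ⊎ₑ g)) ∘ ((H+ inr ∘ t′) ∘ m)   ∎)
      ... | k , h , s = begin
        c (attach p f t) ∘ inl                        ≈⟨ c-functorial left ⟩∘⟨refl ⟨
        (c (attach q k t″) ∘ arrow left) ∘ inl        ≈⟨ trans (pullʳ +₁∘inl) (sym assoc) ⟩
        (c (attach q k t″) ∘ inl) ∘ m                 ≈⟨ pushʳ (sym (trans +₁∘inl identityʳ)) ⟩∘⟨refl ⟩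
        ((c (attach q k t″) ∘ arrow right) ∘ inl) ∘ m ≈⟨ (c-functorial right ⟩∘⟨refl) ⟩∘⟨refl ⟩
        (c (attach q g t′) ∘ inl) ∘ m                 ∎
        where
        t″ = H+ (arrow h) ∘ (H+ inr ∘ t′)

        left : attach p f t ⇛ attach q k t″
        left = attach-map p q m (h ∘ₑ inlₑ {f = g})
          (trans (pushˡ H+-∘) (trans s (sym assoc)))

        right : attach q g t′ ⇛ attach q k t″
        right = attach-map q q id (h ∘ₑ inrₑ {e = f}) (trans (pushˡ H+-∘) (sym identityʳ))

      construct-map : Σ (F₀ C + A ⇒ C) λ u → ∀ {P} (p : IsFP 𝒜 P) (t : P ⇒ F₀ C + A) →
        u ∘ t ≈ c (attach p (proj₁ (factor-H+ p t)) (proj₁ (proj₂ (factor-H+ p t)))) ∘ inl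
      construct-map = fp-glue _ λ p q m r → merge-attach p q m
        (trans (proj₂ (proj₂ (factor-H+ p _)))
          (trans r (sym (proj₂ (proj₂ (factor-H+ q _))) ⟩∘⟨refl)))

    abstract
      destruct : C ⇒ F₀ C + A
      destruct = proj₁ destruct-map

      destruct∘c : ∀ e → destruct ∘ c e ≈ H+ (c e) ∘ eqn e
      destruct∘c = proj₂ destruct-map

      construct : F₀ C + A ⇒ C
      construct = proj₁ construct-map

      construct-attach : ∀ {P} (p : IsFP 𝒜 P) (f : Equation A) (t : P ⇒ F₀ (vars f) + A) →
                         construct ∘ (H+ (c f) ∘ t) ≈ c (attach p f t) ∘ inl
      construct-attach p f t = trans (proj₂ construct-map p _)
        (trans (merge-attach p p id
                 (trans (proj₂ (proj₂ (factor-H+ p (H+ (c f) ∘ t)))) (sym identityʳ))) identityʳ)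

    destruct∘construct : destruct ∘ construct ≈ id
    destruct∘construct = fp-ext λ p t → on p t (factor-H+ p t)
      where
      on : ∀ {P} (p : IsFP 𝒜 P) (t : P ⇒ F₀ C + A) →
           (Σ (Equation A) λ f → Σ (P ⇒ F₀ (vars f) + A) λ t′ → H+ (c f) ∘ t′ ≈ t) →
           (destruct ∘ construct) ∘ t ≈ id ∘ t
      on p t (f , t′ , r) = begin
        (destruct ∘ construct) ∘ t                         ≈⟨ refl⟩∘⟨ sym r ⟩
        (destruct ∘ construct) ∘ (H+ (c f) ∘ t′)           ≈⟨ pullʳ (construct-attach p f t′) ⟩
        destruct ∘ (c w ∘ inl)                             ≈⟨ pullˡ (destruct∘c w) ⟩
        (H+ (c w) ∘ (H+ inr ∘ [ t′ , eqn f ])) ∘ inl       ≈⟨ pullʳ (pullʳ inject₁) ⟩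
        H+ (c w) ∘ (H+ inr ∘ t′)                           ≈⟨ pullˡ (sym H+-∘) ⟩
        H+ (c w ∘ inr) ∘ t′                                ≈⟨ H+-cong (c-functorial (attach-inr p f t′)) ⟩∘⟨refl ⟩
        H+ (c f) ∘ t′                                      ≈⟨ trans r (sym identityˡ) ⟩
        id ∘ t                                             ∎
        where w = attach p f t′

    construct∘destruct : construct ∘ destruct ≈ id
    construct∘destruct = c-ext λ e → begin
      (construct ∘ destruct) ∘ c e                       ≈⟨ pullʳ (destruct∘c e) ⟩
      construct ∘ (H+ (c e) ∘ eqn e)                     ≈⟨ construct-attach (fp e) e (eqn e) ⟩
      c (attach (fp e) e (eqn e)) ∘ inl                  ≈⟨ c-functorial (attach-fold e) ⟩∘⟨refl ⟨
      (c e ∘ [ id , id ]) ∘ inl                          ≈⟨ trans (pullʳ inject₁) (trans identityʳ (sym identityˡ)) ⟩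
      id ∘ c e                                           ∎

    canonical : SolutionFamily construct
    canonical = record
      { κ = c
      ; solves = λ e → sym (trans (refl⟩∘⟨ sym (destruct∘c e)) (cancelˡ construct∘destruct))
      ; κ-functorial = c-functorial
      }

    module _ {B} {β : F₀ B + A ⇒ B} (S : SolutionFamily β) where
      open SolutionFamily S

      private
        fold-map : Σ (C ⇒ B) λ u → ∀ e → u ∘ c e ≈ κ e
        fold-map = universal κ κ-functorial

      fold : C ⇒ B
      fold = proj₁ fold-map

      fold∘c : ∀ e → fold ∘ c e ≈ κ e
      fold∘c = proj₂ fold-map

      -- The cocone computes `destruct`, not `construct`. So the recursive equation `unfold` is
      -- verified first, and cancelling `destruct` against `construct` gives the homomorphism law.
      fold-hom : fold ∘ construct ≈ β ∘ H+ fold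
      fold-hom = begin
        fold ∘ construct                        ≈⟨ unfold ⟩∘⟨refl ⟩
        (β ∘ (H+ fold ∘ destruct)) ∘ construct  ≈⟨ pullʳ (cancelʳ destruct∘construct) ⟩
        β ∘ H+ fold                             ∎
        where
        unfold : fold ≈ β ∘ (H+ fold ∘ destruct)
        unfold = c-ext λ e → begin
          fold ∘ c e                          ≈⟨ fold∘c e ⟩
          κ e                                 ≈⟨ solves e ⟩
          β ∘ (H+ (κ e) ∘ eqn e)              ≈⟨ refl⟩∘⟨ H+-cong (fold∘c e) ⟩∘⟨refl ⟨
          β ∘ (H+ (fold ∘ c e) ∘ eqn e)       ≈⟨ refl⟩∘⟨ pushˡ H+-∘ ⟩
          β ∘ (H+ fold ∘ (H+ (c e) ∘ eqn e))  ≈⟨ sym (pullʳ (pullʳ (destruct∘c e))) ⟩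
          (β ∘ (H+ fold ∘ destruct)) ∘ c e    ∎

    structure : F₀ C ⇒ C
    structure = construct ∘ inl

    -- Both sides of the solution equation factor through H+ (c f), hence are merged by
    -- some h : f ⇛ g; then [h·s, h] is an equation morphism out of the ⊕-sum.
    solution-unique : ∀ {X} (p : IsFP 𝒜 X) (f : Equation A) (e : X ⇒ F₀ X + vars f) (s : X ⇒ vars f) →
                      IsSolution structure (c f • e) (c f ∘ s) →
                      c f ∘ s ≈ c (sumₑ f (fp-+ p (fp f)) e) ∘ inl
    solution-unique p f e s sol
      with merge-H+ p {f} {eqn f ∘ s} {[ inl ∘ F₁ s , eqn f ] ∘ e} (begin
        H+ (c f) ∘ (eqn f ∘ s)                                   ≈⟨ pullˡ (sym (destruct∘c f)) ⟩
        (destruct ∘ c f) ∘ s                                     ≈⟨ pullʳ (trans sol []-solution) ⟩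
        destruct ∘ ([ structure ∘ F₁ (c f ∘ s) , c f ] ∘ e)      ≈⟨ pullˡ ∘[] ⟩
        [ destruct ∘ (structure ∘ F₁ (c f ∘ s)) , destruct ∘ c f ] ∘ e
          ≈⟨ []-cong (trans (pullˡ (cancelˡ destruct∘construct)) (refl⟩∘⟨ homomorphism)) (destruct∘c f) ⟩∘⟨refl ⟩
        [ inl ∘ (F₁ (c f) ∘ F₁ s) , H+ (c f) ∘ eqn f ] ∘ e
          ≈⟨ []-cong (sym (extendʳ +₁∘inl)) refl ⟩∘⟨refl ⟩
        [ H+ (c f) ∘ (inl ∘ F₁ s) , H+ (c f) ∘ eqn f ] ∘ e       ≈⟨ pushˡ (sym ∘[]) ⟩
        H+ (c f) ∘ ([ inl ∘ F₁ s , eqn f ] ∘ e)                  ∎)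
    ... | g , h , r = begin
      c f ∘ s                                          ≈⟨ c-functorial h ⟩∘⟨refl ⟨
      (c g ∘ arrow h) ∘ s                              ≈⟨ trans assoc (refl⟩∘⟨ sym inject₁) ⟩
      c g ∘ ([ arrow h ∘ s , arrow h ] ∘ inl)          ≈⟨ pullˡ (c-functorial m) ⟩
      c (sumₑ f (fp-+ p (fp f)) e) ∘ inl               ∎
      where
      m : sumₑ f (fp-+ p (fp f)) e ⇛ g
      m = sumₑ-elim (fp-+ p (fp f)) (arrow h ∘ s) h (begin
        eqn g ∘ (arrow h ∘ s)                              ≈⟨ extendʳ (sym (commutes h)) ⟩
        H+ (arrow h) ∘ (eqn f ∘ s)                         ≈⟨ r ⟩
        H+ (arrow h) ∘ ([ inl ∘ F₁ s , eqn f ] ∘ e)        ≈⟨ pullˡ ∘[] ⟩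
        [ H+ (arrow h) ∘ (inl ∘ F₁ s) , H+ (arrow h) ∘ eqn f ] ∘ e
          ≈⟨ []-cong (trans (extendʳ +₁∘inl) (refl⟩∘⟨ sym homomorphism)) (commutes h) ⟩∘⟨refl ⟩
        [ inl ∘ F₁ (arrow h ∘ s) , eqn g ∘ arrow h ] ∘ e   ∎)

    structure-iterative : IsIterative C structure
    structure-iterative X p e =
      let (f , e′ , r) = factor-+ p e
      in c (sumₑ f (fp-+ p (fp f)) e′) ∘ inl ,
         trans (SolutionFamily.solves-sum canonical f (fp-+ p (fp f)) e′) (refl⟩∘⟨ refl⟩∘⟨ r) ,
         λ s sol → unique-solution f e′ r s sol (factor p s)
      where
      -- The equation factors at `f` and the rival solution at `g`. Both are moved to `f ⊎ₑ g`,
      -- because `solution-unique` wants them at one stage; `embed` returns to the sum over `f`.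
      unique-solution : ∀ f (e′ : X ⇒ F₀ X + vars f) → c f • e′ ≈ e → ∀ s → IsSolution structure e s →
        (Σ (Equation A) λ g → Σ (X ⇒ vars g) λ s′ → c g ∘ s′ ≈ s) →
        s ≈ c (sumₑ f (fp-+ p (fp f)) e′) ∘ inl
      unique-solution f e′ r s sol (g , s′ , q) = begin
        s                                                     ≈⟨ s-factors ⟨
        c (f ⊎ₑ g) ∘ (inr ∘ s′)                               ≈⟨ solution-unique p (f ⊎ₑ g) (inl • e′) (inr ∘ s′) sol′ ⟩
        c (sumₑ (f ⊎ₑ g) (fp-+ p (fp (f ⊎ₑ g))) (inl • e′)) ∘ inl
                                                              ≈⟨ refl⟩∘⟨ sym inject₁ ⟩
        c (sumₑ (f ⊎ₑ g) (fp-+ p (fp (f ⊎ₑ g))) (inl • e′)) ∘ (arrow embed ∘ inl)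
                                                              ≈⟨ pullˡ (c-functorial embed) ⟩
        c (sumₑ f (fp-+ p (fp f)) e′) ∘ inl                   ∎
        where
        embed : sumₑ f (fp-+ p (fp f)) e′ ⇛ sumₑ (f ⊎ₑ g) (fp-+ p (fp (f ⊎ₑ g))) (inl • e′)
        embed = sumₑ-map (fp-+ p (fp f)) (fp-+ p (fp (f ⊎ₑ g))) e′ (inlₑ {e = f} {g})

        s-factors : c (f ⊎ₑ g) ∘ (inr ∘ s′) ≈ s
        s-factors = trans (pullˡ (c-functorial (inrₑ {e = f}))) q

        e-factors : e ≈ c (f ⊎ₑ g) • (inl • e′)
        e-factors = trans (sym r) (trans (•-cong (sym (c-functorial (inlₑ {f = g}))) refl) (sym •-∘))

        sol′ : IsSolution structure (c (f ⊎ₑ g) • (inl • e′)) (c (f ⊎ₑ g) ∘ (inr ∘ s′))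
        sol′ = trans s-factors (trans sol
          (refl⟩∘⟨ (+₁-cong (F-resp-≈ (sym s-factors)) refl ⟩∘⟨ e-factors)))

  -- The free iterative algebra compared with the colimit

  module RationalAlgebra (lfp : LFP 𝒜) {A : Obj} (K : EquationColimit A) (free : FreeIterative A) where
    open EquationColimit K renaming (apex to C)
    open Fixpoint lfp K
    open FreeIterative free
    open IterativeAlgebra iterative

    approximants : SolutionFamily [ ρ , η ]
    approximants = solutions η

    approx : (e : Equation A) → vars e ⇒ RY
    approx = SolutionFamily.κ approximants

    extend-approx : ∀ {B β} (it : IsIterative B β) (m : A ⇒ B) (e : Equation A) →
                    extend B β it m ∘ approx e ≈ IterativeAlgebra.solve it (fp e) (m • eqn e)
    extend-approx it m e =
      trans (solve-hom iterative it (extend-hom _ _ it m) (fp e) (η • eqn e))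
            (IterativeAlgebra.solve-cong it (fp e) (fp e) (trans •-∘ (•-cong (extend-η _ _ it m) refl)))

    private
      toC : RY ⇒ C
      toC = extend C structure structure-iterative (construct ∘ inr)

      toC-hom : toC ∘ [ ρ , η ] ≈ construct ∘ H+ toC
      toC-hom = +-ext
        (begin
          (toC ∘ [ ρ , η ]) ∘ inl           ≈⟨ pullʳ inject₁ ⟩
          toC ∘ ρ                           ≈⟨ extend-hom _ _ structure-iterative _ ⟩
          structure ∘ F₁ toC                ≈⟨ pullʳ (sym +₁∘inl) ⟩
          construct ∘ (H+ toC ∘ inl)        ≈⟨ sym assoc ⟩
          (construct ∘ H+ toC) ∘ inl        ∎)
        (begin
          (toC ∘ [ ρ , η ]) ∘ inr           ≈⟨ pullʳ inject₂ ⟩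
          toC ∘ η                           ≈⟨ extend-η _ _ structure-iterative _ ⟩
          construct ∘ inr                   ≈⟨ refl⟩∘⟨ sym (trans +₁∘inr identityʳ) ⟩
          construct ∘ (H+ toC ∘ inr)        ≈⟨ sym assoc ⟩
          (construct ∘ H+ toC) ∘ inr        ∎)

      fromC : C ⇒ RY
      fromC = fold approximants

      -- The composite is an algebra endomorphism of the free iterative algebra fixing `η`, hence
      -- the identity.
      fromC∘toC : fromC ∘ toC ≈ id
      fromC∘toC = trans (extend-unique RY ρ iterative η (fromC ∘ toC) hom unit)
                        (sym (extend-unique RY ρ iterative η id id-hom identityˡ))
        where
        id-hom : IsAlgHom ρ ρ id
        id-hom = trans identityˡ (sym (elimʳ identity))

        composite : (fromC ∘ toC) ∘ [ ρ , η ] ≈ [ ρ , η ] ∘ H+ (fromC ∘ toC)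
        composite = begin
          (fromC ∘ toC) ∘ [ ρ , η ]           ≈⟨ pullʳ toC-hom ⟩
          fromC ∘ (construct ∘ H+ toC)        ≈⟨ extendʳ (fold-hom approximants) ⟩
          [ ρ , η ] ∘ (H+ fromC ∘ H+ toC)     ≈⟨ refl⟩∘⟨ sym H+-∘ ⟩
          [ ρ , η ] ∘ H+ (fromC ∘ toC)        ∎

        hom : IsAlgHom ρ ρ (fromC ∘ toC)
        hom = begin
          (fromC ∘ toC) ∘ ρ                     ≈⟨ refl⟩∘⟨ sym inject₁ ⟩
          (fromC ∘ toC) ∘ ([ ρ , η ] ∘ inl)     ≈⟨ extendʳ composite ⟩
          [ ρ , η ] ∘ (H+ (fromC ∘ toC) ∘ inl)  ≈⟨ refl⟩∘⟨ +₁∘inl ⟩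
          [ ρ , η ] ∘ (inl ∘ F₁ (fromC ∘ toC))  ≈⟨ pullˡ inject₁ ⟩
          ρ ∘ F₁ (fromC ∘ toC)                  ∎

        unit : (fromC ∘ toC) ∘ η ≈ η
        unit = begin
          (fromC ∘ toC) ∘ η                     ≈⟨ refl⟩∘⟨ sym inject₂ ⟩
          (fromC ∘ toC) ∘ ([ ρ , η ] ∘ inr)     ≈⟨ extendʳ composite ⟩
          [ ρ , η ] ∘ (H+ (fromC ∘ toC) ∘ inr)  ≈⟨ refl⟩∘⟨ trans +₁∘inr identityʳ ⟩
          [ ρ , η ] ∘ inr                       ≈⟨ inject₂ ⟩
          η                                     ∎

      -- Both sides solve the same equation in C, where solutions are unique.
      toC∘approx : ∀ e → toC ∘ approx e ≈ c e
      toC∘approx e = trans (extend-approx structure-iterative (construct ∘ inr) e)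
        (sym (IterativeAlgebra.solve-unique structure-iterative (fp e) refl
          (trans (SolutionFamily.solves canonical e)
            (trans (unique refl refl ⟩∘⟨refl) (sym •-solution)))))

    approx-ext : ∀ {B} {u v : RY ⇒ B} → (∀ e → u ∘ approx e ≈ v ∘ approx e) → u ≈ v
    approx-ext {u = u} {v} p = begin
      u                    ≈⟨ elimʳ fromC∘toC ⟨
      u ∘ (fromC ∘ toC)    ≈⟨ extendʳ (c-ext (λ e → trans (pullʳ (fold∘c approximants e))
                                (trans (p e) (sym (pullʳ (fold∘c approximants e)))))) ⟩
      v ∘ (fromC ∘ toC)    ≈⟨ elimʳ fromC∘toC ⟩
      v                    ∎

    -- The parameters are carried to C, factored through the cocone there, and carried back along
    -- the retraction `fromC`.
    factor-approx : ∀ {X} → IsFP 𝒜 X → (e : X ⇒ F₀ X + RY) →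
                    Σ (Equation A) λ f → Σ (X ⇒ F₀ X + vars f) λ e′ → approx f • e′ ≈ e
    factor-approx p e =
      let (f , e′ , r) = factor-+ p (toC • e)
      in f , e′ , (begin
        approx f • e′              ≈⟨ •-cong (sym (fold∘c approximants f)) refl ⟩
        (fromC ∘ c f) • e′         ≈⟨ sym •-∘ ⟩
        fromC • (c f • e′)         ≈⟨ refl⟩∘⟨ r ⟩
        fromC • (toC • e)          ≈⟨ •-∘ ⟩
        (fromC ∘ toC) • e          ≈⟨ •-cong fromC∘toC refl ⟩
        id • e                     ≈⟨ id-• ⟩
        e                          ∎)

    module _ {B} {β : F₀ B + A ⇒ B} (S : SolutionFamily β) where
      private
        evaluation : Σ (RY ⇒ B) λ a → (∀ e → a ∘ approx e ≈ SolutionFamily.κ S e) ×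
                                      (a ∘ [ ρ , η ] ≈ β ∘ H+ a)
        evaluation = fold S ∘ toC ,
          (λ e → trans (pullʳ (toC∘approx e)) (fold∘c S e)) ,
          trans (pullʳ toC-hom) (trans (extendʳ (fold-hom S)) (refl⟩∘⟨ sym H+-∘))

      abstract
        -- The extension that `extend` cannot provide: B need not be iterative, only equipped with a
        -- functorial family of solutions.
        evaluate : RY ⇒ B
        evaluate = proj₁ evaluation

        evaluate-approx : ∀ e → evaluate ∘ approx e ≈ SolutionFamily.κ S e
        evaluate-approx = proj₁ (proj₂ evaluation)

        evaluate-hom : evaluate ∘ [ ρ , η ] ≈ β ∘ H+ evaluate
        evaluate-hom = proj₂ (proj₂ evaluation)

    -- Uniqueness of solutions in RA upgrades `solves-sum` to compositionality.
    approx-sum : ∀ {X} (p : IsFP 𝒜 X) (f : Equation A) (r : IsFP 𝒜 (X + vars f)) (e : X ⇒ F₀ X + vars f) →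
                 solve p (approx f • e) ≈ approx (sumₑ f r e) ∘ inl
    approx-sum p f r e = sym (solve-unique p refl
      (trans (SolutionFamily.solves-sum approximants f r e) ([]-cong inject₁ refl ⟩∘⟨refl)))

-- Elgot algebras and Eilenberg-Moore algebras

module ElgotEilenbergMoore {o ℓ} {𝒜 : Category o ℓ ℓ} (lfp : LFP 𝒜) (cp : BinaryCoproducts 𝒜)
                           (H : Functor 𝒜 𝒜) (finitary : Finitary 𝒜 H)
                           (FI : ∀ Y → Algebras.FreeIterative cp H Y) where
  open Category 𝒜
  open Morphisms 𝒜
  open BinaryCoproducts cp
  open Coproducts cp
  open FilteredCoproducts cp using (fp-+)
  open Functor H
  open Algebras cp H
  open Equations cp H
  open Solutions cp H
  open Rational FI

  private
    module R (A : Obj) where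
      open FreeIterative (FI A) public
      open RationalAlgebra lfp (equation-colimit lfp finitary A) (FI A) public
      open IterativeAlgebra iterative public

  R₁-approx : ∀ {A B} (h : A ⇒ B) (e : Equation A) →
              R₁ h ∘ R.approx A e ≈ R.approx B (equation (fp e) (h • eqn e))
  R₁-approx {A} {B} h e = trans (R.extend-approx A (R.iterative B) (ηR ∘ h) e)
    (R.solve-cong B (fp e) (fp e) (sym •-∘))

  R₁-hom : ∀ {A B} (h : A ⇒ B) → IsAlgHom (R.ρ A) (R.ρ B) (R₁ h)
  R₁-hom {A} {B} h = R.extend-hom A _ _ (R.iterative B) (ηR ∘ h)

  R₁-η : ∀ {A B} (h : A ⇒ B) → R₁ h ∘ ηR ≈ ηR ∘ h
  R₁-η {A} {B} h = R.extend-η A _ _ (R.iterative B) (ηR ∘ h)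

  -- On approximants the multiplication is solving in RA, which is why the multiplication law
  -- becomes a statement about equations with parameters in RA.
  μ-approx : ∀ {A} (e : Equation (R₀ A)) → μR ∘ R.approx (R₀ A) e ≈ R.solve A (fp e) (eqn e)
  μ-approx {A} e = trans (R.extend-approx (R₀ A) (R.iterative A) id e)
    (R.solve-cong A (fp e) (fp e) id-•)

  μ-hom : ∀ {A} → IsAlgHom (R.ρ (R₀ A)) (R.ρ A) (μR {A})
  μ-hom {A} = R.extend-hom (R₀ A) _ _ (R.iterative A) id

  μ-η : ∀ {A} → μR {A} ∘ ηR ≈ id
  μ-η {A} = R.extend-η (R₀ A) _ _ (R.iterative A) id

  module FromElgot {A : Obj} (s : ElgotStr A) where
    open ElgotStr s

    -- Functoriality at the identity absorbs both a change of equation up to equality and a change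
    -- of witness.
    sol-cong : ∀ {X} (p q : IsFP 𝒜 X) {e e′ : X ⇒ F₀ X + A} → e ≈ e′ → sol p e ≈ sol q e′
    sol-cong p q r = trans (functorial p q _ _ id (trans (elimˡ H+-identity) (trans r (sym identityʳ)))) identityʳ

    family : SolutionFamily [ α , id ]
    family = record
      { κ = λ e → sol (fp e) (eqn e)
      ; solves = λ e → solution (fp e) (eqn e)
      ; κ-functorial = λ {e} {f} h → sym (functorial (fp e) (fp f) _ _ (arrow h) (commutes h))
      }

    a : R₀ A ⇒ A
    a = R.evaluate A family

    a-approx : ∀ e → a ∘ R.approx A e ≈ sol (fp e) (eqn e)
    a-approx = R.evaluate-approx A family

    a-hom : IsAlgHom (R.ρ A) α a
    a-hom = begin
      a ∘ R.ρ A                        ≈⟨ refl⟩∘⟨ sym inject₁ ⟩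
      a ∘ ([ R.ρ A , ηR ] ∘ inl)       ≈⟨ extendʳ (R.evaluate-hom A family) ⟩
      [ α , id ] ∘ (H+ a ∘ inl)        ≈⟨ refl⟩∘⟨ +₁∘inl ⟩
      [ α , id ] ∘ (inl ∘ F₁ a)        ≈⟨ pullˡ inject₁ ⟩
      α ∘ F₁ a                         ∎

    a-unit : a ∘ ηR ≈ id
    a-unit = begin
      a ∘ ηR                           ≈⟨ refl⟩∘⟨ sym inject₂ ⟩
      a ∘ ([ R.ρ A , ηR ] ∘ inr)       ≈⟨ extendʳ (R.evaluate-hom A family) ⟩
      [ α , id ] ∘ (H+ a ∘ inr)        ≈⟨ refl⟩∘⟨ trans +₁∘inr identityʳ ⟩
      [ α , id ] ∘ inr                 ≈⟨ inject₂ ⟩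
      id                               ∎

    -- The parameters of `e` come from a single approximant `f`, so its solution in RA is part of an
    -- approximant for a ⊕-sum. There `a` returns the chosen solution, and compositionality splits
    -- the sum again.
    a-solve : ∀ {X} (p : IsFP 𝒜 X) (e : X ⇒ F₀ X + R₀ A) → a ∘ R.solve A p e ≈ sol p (a • e)
    a-solve {X} p e = on (R.factor-approx A p e)
      where
      on : (Σ (Equation A) λ f → Σ (X ⇒ F₀ X + vars f) λ e′ → R.approx A f • e′ ≈ e) →
           a ∘ R.solve A p e ≈ sol p (a • e)
      on (f , e′ , r) = begin
        a ∘ R.solve A p e                         ≈⟨ refl⟩∘⟨ R.solve-cong A p p (sym r) ⟩
        a ∘ R.solve A p (R.approx A f • e′)       ≈⟨ refl⟩∘⟨ R.approx-sum A p f q e′ ⟩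
        a ∘ (R.approx A (sumₑ f q e′) ∘ inl)      ≈⟨ pullˡ (a-approx (sumₑ f q e′)) ⟩
        sol q (eqn f ⊕ e′) ∘ inl                  ≈⟨ compositional p (fp f) q e′ (eqn f) ⟨
        sol p (sol (fp f) (eqn f) • e′)           ≈⟨ sol-cong p p (•-cong (sym (a-approx f)) refl) ⟩
        sol p ((a ∘ R.approx A f) • e′)           ≈⟨ sol-cong p p (sym •-∘) ⟩
        sol p (a • (R.approx A f • e′))           ≈⟨ sol-cong p p (refl⟩∘⟨ r) ⟩
        sol p (a • e)                             ∎
        where q = fp-+ p (fp f)

    emStr : EMStr A
    emStr = record
      { a = a
      ; unit-law = a-unit
      ; mult-law = R.approx-ext (R₀ A) λ e → begin
          (a ∘ μR) ∘ R.approx (R₀ A) e                        ≈⟨ pullʳ (μ-approx e) ⟩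
          a ∘ R.solve A (fp e) (eqn e)                        ≈⟨ a-solve (fp e) (eqn e) ⟩
          sol (fp e) (a • eqn e)                              ≈⟨ a-approx (equation (fp e) (a • eqn e)) ⟨
          a ∘ R.approx A (equation (fp e) (a • eqn e))        ≈⟨ sym (pullʳ (R₁-approx a e)) ⟩
          (a ∘ R₁ a) ∘ R.approx (R₀ A) e                      ∎
      }

  module FromEM {A : Obj} (t : EMStr A) where
    open EMStr t

    -- Restriction of `a` along the canonical transformation from H to R, namely ρ · Hη.
    α : F₀ A ⇒ A
    α = a ∘ (R.ρ A ∘ F₁ ηR)

    a-hom : IsAlgHom (R.ρ A) α a
    a-hom = sym (begin
      (a ∘ (R.ρ A ∘ F₁ ηR)) ∘ F₁ a          ≈⟨ trans assoc (refl⟩∘⟨ assoc) ⟩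
      a ∘ (R.ρ A ∘ (F₁ ηR ∘ F₁ a))          ≈⟨ refl⟩∘⟨ refl⟩∘⟨ trans (sym homomorphism)
                                               (trans (F-resp-≈ (sym (R₁-η a))) homomorphism) ⟩
      a ∘ (R.ρ A ∘ (F₁ (R₁ a) ∘ F₁ ηR))     ≈⟨ refl⟩∘⟨ extendʳ (sym (R₁-hom a)) ⟩
      a ∘ (R₁ a ∘ (R.ρ (R₀ A) ∘ F₁ ηR))     ≈⟨ extendʳ (sym mult-law) ⟩
      a ∘ (μR ∘ (R.ρ (R₀ A) ∘ F₁ ηR))       ≈⟨ refl⟩∘⟨ extendʳ μ-hom ⟩
      a ∘ (R.ρ A ∘ (F₁ μR ∘ F₁ ηR))         ≈⟨ refl⟩∘⟨ elimʳ (trans (sym homomorphism)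
                                               (trans (F-resp-≈ μ-η) identity)) ⟩
      a ∘ R.ρ A                             ∎)

    sol : ∀ {X} → IsFP 𝒜 X → X ⇒ F₀ X + A → X ⇒ A
    sol p e = a ∘ R.approx A (equation p e)

    a-solve : ∀ {X} (p : IsFP 𝒜 X) (e : X ⇒ F₀ X + R₀ A) → a ∘ R.solve A p e ≈ sol p (a • e)
    a-solve p e = begin
      a ∘ R.solve A p e                             ≈⟨ refl⟩∘⟨ μ-approx (equation p e) ⟨
      a ∘ (μR ∘ R.approx (R₀ A) (equation p e))     ≈⟨ extendʳ mult-law ⟩
      a ∘ (R₁ a ∘ R.approx (R₀ A) (equation p e))   ≈⟨ refl⟩∘⟨ R₁-approx a (equation p e) ⟩
      sol p (a • e)                                 ∎

    elgotStr : ElgotStr A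
    elgotStr = record
      { α = α
      ; sol = sol
      -- The solution of `ηR • e` in RA is carried along the homomorphism `a`; the unit law turns
      -- its parameters back into those of `e`.
      ; solution = λ p e → trans
          (hom-solution a-hom (R.solve-solution A p (ηR • e)))
          (refl⟩∘⟨ refl⟩∘⟨ trans •-∘ (trans (•-cong unit-law refl) id-•))
      ; functorial = λ p q e f h r → sym (pullʳ
          (SolutionFamily.κ-functorial (R.approximants A) {equation p e} {equation q f}
            (record { arrow = h ; commutes = r })))
      -- Since `sol` applies `ηR` and then `a`, the inner `a` can be pulled out of the parameters;
      -- the multiplication law, through `a-solve`, moves the problem into RA, where `approx-sum`
      -- settles it.
      ; compositional = λ p q r e f → begin
          sol p ((a ∘ R.approx A (equation q f)) • e)
            ≈⟨ refl⟩∘⟨ R.solve-cong A p p (refl⟩∘⟨ sym •-∘) ⟩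
          sol p (a • (R.approx A (equation q f) • e))
            ≈⟨ a-solve p (R.approx A (equation q f) • e) ⟨
          a ∘ R.solve A p (R.approx A (equation q f) • e)
            ≈⟨ pushʳ (R.approx-sum A p (equation q f) r e) ⟩
          (a ∘ R.approx A (equation r (f ⊕ e))) ∘ inl
            ∎
      }

  module _ {A : Obj} (s : ElgotStr A) where
    open ElgotStr s
    open FromElgot s

    elgot-em-elgot : FromEM.elgotStr emStr ≃Elgot s
    elgot-em-elgot =
      (begin
        a ∘ (R.ρ A ∘ F₁ ηR)    ≈⟨ extendʳ a-hom ⟩
        α ∘ (F₁ a ∘ F₁ ηR)     ≈⟨ elimʳ (trans (sym homomorphism) (trans (F-resp-≈ a-unit) identity)) ⟩
        α                      ∎) ,
      λ p e → a-approx (equation p e)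

  -- Approximants are jointly epic, and on them both structures return the solution that `t`
  -- induces.
  em-elgot-em : ∀ {A} (t : EMStr A) → FromElgot.emStr (FromEM.elgotStr t) ≃EM t
  em-elgot-em {A} t = R.approx-ext A (FromElgot.a-approx (FromEM.elgotStr t))

  module _ {A B : Obj} (s : ElgotStr A) (s′ : ElgotStr B) (h : A ⇒ B) where
    private
      module S = FromElgot s
      module S′ = FromElgot s′

    preserving⇒em-hom : SolPreserving s s′ h → IsEMHom S.emStr S′.emStr h
    preserving⇒em-hom preserves = R.approx-ext A λ e → begin
      (h ∘ S.a) ∘ R.approx A e                          ≈⟨ pullʳ (S.a-approx e) ⟩
      h ∘ ElgotStr.sol s (fp e) (eqn e)                 ≈⟨ preserves (fp e) (eqn e) ⟩
      ElgotStr.sol s′ (fp e) (h • eqn e)                ≈⟨ S′.a-approx (equation (fp e) (h • eqn e)) ⟨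
      S′.a ∘ R.approx B (equation (fp e) (h • eqn e))   ≈⟨ sym (pullʳ (R₁-approx h e)) ⟩
      (S′.a ∘ R₁ h) ∘ R.approx A e                      ∎

  em-hom⇒preserving : ∀ {A B} (t : EMStr A) (t′ : EMStr B) (h : A ⇒ B) → IsEMHom t t′ h →
                      SolPreserving (FromEM.elgotStr t) (FromEM.elgotStr t′) h
  em-hom⇒preserving {A} {B} t t′ h hom p e = begin
    h ∘ (EMStr.a t ∘ R.approx A (equation p e))         ≈⟨ extendʳ hom ⟩
    EMStr.a t′ ∘ (R₁ h ∘ R.approx A (equation p e))     ≈⟨ refl⟩∘⟨ R₁-approx h (equation p e) ⟩
    EMStr.a t′ ∘ R.approx B (equation p (h • e))        ∎

  elgot-iso-em : ElgotIsoEM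
  elgot-iso-em = record
    { Φ = FromElgot.emStr
    ; Ψ = FromEM.elgotStr
    ; ΨΦ = elgot-em-elgot
    ; ΦΨ = em-elgot-em
    ; Φ-hom = preserving⇒em-hom
    ; Ψ-hom = em-hom⇒preserving
    }

theorem4p6 : ∀ {o ℓ : Level} (𝒜 : Category o ℓ ℓ) → LFP 𝒜 →
    (cp : BinaryCoproducts 𝒜) (H : Functor 𝒜 𝒜) → Finitary 𝒜 H →
    (FI : (Y : Category.Obj 𝒜) → Algebras.FreeIterative cp H Y) →
    Algebras.Rational.ElgotIsoEM cp H FI
theorem4p6 𝒜 lfp cp H finitary FI = ElgotEilenbergMoore.elgot-iso-em lfp cp H finitary FI
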